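{- Let $k \in \mathbb{N}_0$, $h \ge k+1$, let $T$ be an extremal tree of Horton–Strahler number $k+1$ and height $h$ with inner nodes labelled injectively by variables, let $F := D(F_1(T))$ and $m := 1+h-k$. Then $$\nu(\mathcal{T}_k(F)) \ge \binom{m}{\lfloor m/2\rfloor} > \frac{1}{\sqrt{2}}\frac{2^m}{\sqrt{m}} = \Theta\!\left(\frac{2^h}{\sqrt{h}}\right),$$ where the second inequality assumes $h \ge k+5$ and the $\Theta$-estimate is for fixed $k$.
   Context: Clauses are finite sets of literals without complementary pair, clause-sets finite sets of clauses. For a clause $C$, $\varphi_C$ is the partial assignment setting all literals of $C$ to $0$, $\overline{C}$ the set of complements. The prime implicates $\mathrm{prc}_0(F)$ of a clause-set $F$ are the inclusion-minimal clauses $C$ with $F \models C$. Tree clause-sets: for a full binary tree $T$ with inner nodes labelled injectively by variables, the edge from an inner node labelled $v$ to its left child is labelled $v$, to its right child $\overline{v}$; for a leaf $w$, $C_w$ is the set of edge labels on the root-to-$w$ path; $F_1(T) := \{C_w : w \text{ leaf}\}$. Doping: each clause $C \in G$ receives a distinct new variable $u_C \notin \mathrm{var}(G)$ and $D(G) := \{C\cup\{u_C\} : C \in G\}$. Horton–Strahler number: $0$ for a one-node tree; for a tree with subtrees $T_1,T_2$ it is $1+\mathrm{hts}(T_1)$ if $\mathrm{hts}(T_1)=\mathrm{hts}(T_2)$, else the maximum. An extremal tree of Horton–Strahler number $k$ and height $h$ (for $h\ge k$, $k=0\Rightarrow h=0$) is a full binary tree $T$ with $\mathrm{hts}(T)=k$,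 height $h$, and at least as many nodes as any full binary tree with Horton–Strahler number $\le k$ and height $\le h$. Trigger hypergraph $\mathcal{T}_k(F)$: vertex set $\mathrm{prc}_0(F)$, hyperedges $E^k_C := \{C' \in \mathrm{prc}_0(F) : C' \cap \overline{C} = \emptyset \text{ and } |C'\setminus C| \le k\}$ for all $C \in \mathrm{prc}_0(F)$. $\nu(G)$ is the matching number (maximum number of pairwise disjoint hyperedges) of a hypergraph $G$. -}

module Defs where

open import Data.Nat using (ℕ; zero; suc; _+_; _*_; _≤_; _⊔_)
open import Data.Bool using (Bool; true; false; not; T)
open import Data.List using (List; []; _∷_; _++_; map; length; concatMap; zipWith)
open import Data.List.Membership.Propositional using (_∈_; _∉_)
open import Data.List.Relation.Binary.Subset.Propositional using (_⊆_)
open import Data.List.Relation.Unary.Any using (Any)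
open import Data.List.Relation.Unary.All using (All)
open import Data.List.Relation.Unary.Unique.Propositional using (Unique)
open import Data.Fin using (Fin)
open import Data.Product using (Σ; ∃; _×_; _,_)
open import Relation.Binary.PropositionalEquality using (_≡_; _≢_)
open import Relation.Nullary using (¬_)

record Lit : Set where
  constructor lit
  field
    var  : ℕ
    sign : Bool
open Lit public

pos neg : ℕ → Lit
pos v = lit v true
neg v = lit v false

compl : Lit → Lit
compl (lit v s) = lit v (not s)

-- Clauses are finite sets of literals, represented by lists (read as sets
-- via membership); clause-sets are finite sets of clauses, likewise lists.
Clause : Set
Clause = List Lit

ClauseSet : Set
ClauseSet = List Clause

IsClause : Clause → Set
IsClause C = ∀ x → x ∈ C → compl x ∉ C

varCS : ClauseSet → List ℕ
varCS F = concatMap (map var) F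

Assignment : Set
Assignment = ℕ → Bool

litVal : Assignment → Lit → Bool
litVal α (lit v true)  = α v
litVal α (lit v false) = not (α v)

SatC : Assignment → Clause → Set
SatC α C = Any (λ x → T (litVal α x)) C

SatF : Assignment → ClauseSet → Set
SatF α F = All (SatC α) F

_⊨_ : ClauseSet → Clause → Set
F ⊨ C = ∀ (α : Assignment) → SatF α F → SatC α C

IsPrimeImplicate : ClauseSet → Clause → Set
IsPrimeImplicate F C =
  IsClause C × F ⊨ C ×
  (∀ C' → IsClause C' → C' ⊆ C → F ⊨ C' → C ⊆ C')

DisjointFromCompl : Clause → Clause → Set
DisjointFromCompl C' C = ∀ x → x ∈ C' → compl x ∉ C

CardDiff≤ : Clause → Clause → ℕ → Set
CardDiff≤ C' C k =
  Σ (List Lit) λ L → length L ≤ k × (∀ x → x ∈ C' → x ∉ C → x ∈ L)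

record Hypergraph : Set₁ where
  field
    Vertex : Set
    Edge   : Set                    -- index set of the hyperedges
    _∈ₑ_   : Vertex → Edge → Set

MatchingNumber≥ : Hypergraph → ℕ → Set
MatchingNumber≥ G N =
  Σ (Fin N → Edge) λ e →
    (∀ i → ∃ λ v → v ∈ₑ e i) ×
    (∀ i j → i ≢ j → ∀ v → ¬ (v ∈ₑ e i × v ∈ₑ e j))
  where open Hypergraph G

PrimeImplicate : ClauseSet → Set
PrimeImplicate F = Σ Clause (IsPrimeImplicate F)

TriggerHypergraph : ℕ → ClauseSet → Hypergraph
TriggerHypergraph k F = record
  { Vertex = PrimeImplicate F
  ; Edge   = PrimeImplicate F
  ; _∈ₑ_   = λ { (C' , _) (C , _) → DisjointFromCompl C' C × CardDiff≤ C' C k }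
  }

data Tree : Set where
  leaf : Tree
  node : ℕ → Tree → Tree → Tree

innerLabels : Tree → List ℕ
innerLabels leaf         = []
innerLabels (node v l r) = v ∷ innerLabels l ++ innerLabels r

InjectivelyLabelled : Tree → Set
InjectivelyLabelled T = Unique (innerLabels T)

F₁ : Tree → ClauseSet
F₁ leaf         = [] ∷ []
F₁ (node v l r) = map (pos v ∷_) (F₁ l) ++ map (neg v ∷_) (F₁ r)

height : Tree → ℕ
height leaf         = 0
height (node _ l r) = suc (height l ⊔ height r)

size : Tree → ℕ
size leaf         = 1
size (node _ l r) = suc (size l + size r)

hts : Tree → ℕ
hts leaf = 0
hts (node _ l r) with hts l Data.Nat.≟ hts r
... | Relation.Nullary.yes _ = suc (hts l)
... | Relation.Nullary.no  _ = hts l ⊔ hts r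

IsExtremal : ℕ → ℕ → Tree → Set
IsExtremal k h T =
  hts T ≡ k × height T ≡ h ×
  (∀ T' → hts T' ≤ k → height T' ≤ h → size T' ≤ size T)

ValidDoping : ClauseSet → List ℕ → Set
ValidDoping G us =
  length us ≡ length G × Unique us × (∀ u → u ∈ us → u ∉ varCS G)

D : ClauseSet → List ℕ → ClauseSet
D G us = zipWith (λ C u → pos u ∷ C) G us

module Submission where

open import Defs
open import Data.Nat using (ℕ; zero; suc; _+_; _*_; _∸_; _^_; _≤_; _<_; _⊔_; _/_; _≤?_; z≤n; s≤s; s≤s⁻¹; NonZero)
open import Data.Nat.Properties
open import Data.Nat.Combinatorics using (_C_; nC1≡n; nCk≡nC[n∸k]; nCk+nC[k+1]≡[n+1]C[k+1])
open import Data.Nat.DivMod using (m*n/n≡m; m≥n⇒m/n>0; +-distrib-/-∣ʳ)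
open import Data.Nat.Divisibility using (n∣m*n)
open import Data.Nat.Tactic.RingSolver using (solve-∀)
open import Data.Bool using (Bool; true; false; not; T; if_then_else_)
import Data.Bool.Properties as Bool
open import Data.Empty using (⊥; ⊥-elim)
open import Data.Fin as Fin using (Fin; zero; suc)
import Data.Fin.Properties as Fin
open import Data.List using (List; []; _∷_; _++_; map; length; filter; lookup; take; drop)
open import Data.List.Properties using (++-assoc; ++-conicalˡ; concatMap-++; filter-++; filter-some; filter-accept; length-++; length-drop; length-map; length-take; map-++; take++drop≡id)
open import Data.List.Membership.Propositional using (_∈_; _∉_; find; lose)
import Data.List.Membership.DecPropositional as DecMembership
open import Data.List.Membership.Propositional.Properties using (∈-++⁺ˡ; ∈-++⁺ʳ; ∈-++⁻; ∈-∃++; ∈-filter⁻; ∈-lookup; ∈-map⁺)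
open import Data.List.Relation.Unary.All as All using (All; []; _∷_)
import Data.List.Relation.Unary.All.Properties as All
open import Data.List.Relation.Unary.AllPairs using (AllPairs; []; _∷_)
import Data.List.Relation.Unary.AllPairs.Properties as AllPairs
open import Data.List.Relation.Unary.Any as Any using (Any; here; there; any?)
import Data.List.Relation.Unary.Any.Properties as Any
open import Data.List.Relation.Unary.Unique.Propositional using (Unique)
import Data.List.Relation.Unary.Unique.Propositional.Properties as Unique
open import Data.List.Relation.Binary.Permutation.Propositional using (_↭_; prep; swap; ↭-refl; ↭-reflexive; ↭-sym; ↭-trans; ↭⇒↭ₛ)
import Data.List.Relation.Binary.Permutation.Propositional.Properties as Perm
import Data.List.Relation.Binary.Permutation.Setoid.Properties as PermSetoid
open import Data.List.Relation.Binary.Sublist.Propositional as Sub using ([]; _∷_; _∷ʳ_) renaming (_⊆_ to _⊑_)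
import Data.List.Relation.Binary.Sublist.Propositional.Properties as Sub
open import Data.List.Relation.Binary.Subset.Propositional using (_⊆_)
open import Data.Product using (∃; _×_; _,_; proj₁; proj₂)
open import Data.Sum as Sum using (_⊎_; inj₁; inj₂; [_,_]′)
open import Data.Unit using (tt)
open import Algebra.Bundles using (CommutativeMonoid)
import Algebra.Properties.CommutativeSemigroup as CommutativeSemigroup
open import Function using (_∘_; id)
open import Relation.Binary.PropositionalEquality
open import Relation.Nullary using (¬_; Dec; yes; no; contradiction)
open import Relation.Nullary.Decidable using (_×-dec_; ¬?; decidable-stable; map′; toSum)
open import Relation.Unary using (Decidable)

-- Every nonempty set of leaves of T gives a prime implicate of the doped tree
-- clause-set. Call a family of leaf sets a code for k if no implicate lies in the
-- k-hyperedges of two of them, and each clause has at least k + 2 literals outside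
-- every other one (or clashes with it). Codes for k on both subtrees of a node,
-- with the same index set, combine by pairwise union to a code for k + 1. Indeed,
-- let an implicate E lie in the hyperedges of the words i ≠ j. If E contains the
-- root variable, it is an implicate of one subtree, with at most k extra literals
-- there. Otherwise it is an implicate of both subtrees, and having at most k + 1
-- extra literals against either word forces that on one subtree E contains one
-- word and has at most k + 1 literals outside the other, against the second
-- condition. For k = 0 the sets of ⌊m/2⌋ among m leaves form a code. By
-- extremality every subtree at depth k is maximal for Horton–Strahler number at
-- least 1 and height h − k, so it has at least as many leaves as a comb, namely m.

-- Lists without repetition

AllPairs-resp-⊑ : ∀ {A : Set} {R : A → A → Set} {xs ys} → xs ⊑ ys → AllPairs R ys → AllPairs R xs
AllPairs-resp-⊑ []         _          = []
AllPairs-resp-⊑ (_ ∷ʳ p)   (_ ∷ rs)   = AllPairs-resp-⊑ p rs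
AllPairs-resp-⊑ (refl ∷ p) (r ∷ rs)   = Sub.All-resp-⊆ p r ∷ AllPairs-resp-⊑ p rs

Unique-++⁻-disjoint : ∀ {A : Set} (xs : List A) {ys x} → Unique (xs ++ ys) → x ∈ xs → x ∉ ys
Unique-++⁻-disjoint (x ∷ xs) (px ∷ _) (here refl) x∈ys = All.lookup px (∈-++⁺ʳ xs x∈ys) refl
Unique-++⁻-disjoint (x ∷ xs) (_ ∷ p)  (there q)   x∈ys = Unique-++⁻-disjoint xs p q x∈ys

Unique-resp-↭ : ∀ {A : Set} {xs ys : List A} → xs ↭ ys → Unique xs → Unique ys
Unique-resp-↭ {A} p = PermSetoid.Unique-resp-↭ (setoid A) (↭⇒↭ₛ p)

Unique-⊆⇒length≤ : ∀ {A : Set} {xs ys : List A} → Unique xs → xs ⊆ ys → length xs ≤ length ys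
Unique-⊆⇒length≤ {xs = []} _ _ = z≤n
Unique-⊆⇒length≤ {xs = x ∷ xs} {ys} (x∉xs ∷ u) xs⊆ys with ∈-∃++ (xs⊆ys (here refl))
... | as , bs , refl = ≤-trans (s≤s (Unique-⊆⇒length≤ u sub))
                               (≤-reflexive (sym (Perm.↭-length (Perm.shift x as bs))))
  where
  sub : xs ⊆ as ++ bs
  sub y∈xs with Perm.∈-resp-↭ (Perm.shift x as bs) (xs⊆ys (there y∈xs))
  ... | here refl = contradiction refl (All.lookup x∉xs y∈xs)
  ... | there q   = q

map-Unique-injective : ∀ {A B : Set} (f : A → B) {xs x y} → Unique (map f xs) → x ∈ xs → y ∈ xs → f x ≡ f y → x ≡ y
map-Unique-injective f (_ ∷ _) (here refl) (here refl) _ = refl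
map-Unique-injective f (p ∷ _) (here refl) (there q)  e = contradiction e (All.lookup p (∈-map⁺ f q))
map-Unique-injective f (p ∷ _) (there q)  (here refl) e = contradiction (sym e) (All.lookup p (∈-map⁺ f q))
map-Unique-injective f (_ ∷ u) (there p) (there q) e = map-Unique-injective f u p q e

++-interchange : ∀ {A : Set} (as bs cs ds : List A) → (as ++ bs) ++ (cs ++ ds) ↭ (as ++ cs) ++ (bs ++ ds)
++-interchange {A} = CommutativeSemigroup.interchange (CommutativeMonoid.commutativeSemigroup (Perm.++-commutativeMonoid {A = A}))

-- Doped trees

-- Trees whose inner nodes carry the branching variables and whose leaves carry the doping variables.
data DTree : Set where
  leaf : ℕ → DTree
  node : ℕ → DTree → DTree → DTree

skeleton : DTree → Tree
skeleton (leaf _)     = leaf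
skeleton (node v l r) = node v (skeleton l) (skeleton r)

leafLabels : DTree → List ℕ
leafLabels (leaf u)     = u ∷ []
leafLabels (node _ l r) = leafLabels l ++ leafLabels r

vars : DTree → List ℕ
vars (leaf u)     = u ∷ []
vars (node v l r) = v ∷ vars l ++ vars r

clauses : DTree → ClauseSet
clauses t = D (F₁ (skeleton t)) (leafLabels t)

length-F₁-skeleton : ∀ t → length (F₁ (skeleton t)) ≡ length (leafLabels t)
length-F₁-skeleton (leaf _) = refl
length-F₁-skeleton (node v l r) = begin
  length (map (pos v ∷_) L ++ map (neg v ∷_) R)  ≡⟨ length-++ (map (pos v ∷_) L) ⟩
  length (map (pos v ∷_) L) + length (map (neg v ∷_) R) ≡⟨ cong₂ _+_ (length-map _ L) (length-map _ R) ⟩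
  length L + length R ≡⟨ cong₂ _+_ (length-F₁-skeleton l) (length-F₁-skeleton r) ⟩
  length (leafLabels l) + length (leafLabels r) ≡⟨ length-++ (leafLabels l) ⟨
  length (leafLabels l ++ leafLabels r) ∎
  where
  open ≡-Reasoning
  L = F₁ (skeleton l)
  R = F₁ (skeleton r)

-- `D` hands out the doping variables in the left-to-right order of the leaves, so the list can be
-- cut at the number of leaves of the left subtree. Inductions then run over one tree that holds
-- both kinds of variables.
attach : ∀ S us → length us ≡ length (F₁ S) → ∃ λ t → skeleton t ≡ S × leafLabels t ≡ us
attach leaf (u ∷ []) _ = leaf u , refl , refl
attach (node v l r) us eq = node v (proj₁ L) (proj₁ R)
    , cong₂ (node v) (proj₁ (proj₂ L)) (proj₁ (proj₂ R))
    , trans (cong₂ _++_ (proj₂ (proj₂ L)) (proj₂ (proj₂ R))) (take++drop≡id a us)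
  where
  a = length (F₁ l)
  b = length (F₁ r)
  eq′ : length us ≡ a + b
  eq′ = trans eq (trans (length-++ (map (pos v ∷_) (F₁ l))) (cong₂ _+_ (length-map _ (F₁ l)) (length-map _ (F₁ r))))
  L = attach l (take a us) (trans (length-take a us) (m≤n⇒m⊓n≡m (≤-trans (m≤m+n a b) (≤-reflexive (sym eq′)))))
  R = attach r (drop a us) (trans (length-drop a us) (trans (cong (_∸ a) eq′) (m+n∸m≡n a b)))

-- Doping variables are assumed fresh for `varCS`; this makes them differ from the branching
-- variables. A node label occurs because its left subtree has at least one leaf, whose clause
-- receives the positive edge literal.
innerLabels⊆varCS : ∀ S → innerLabels S ⊆ varCS (F₁ S)
innerLabels⊆varCS (node v l r) {x} x∈ = subst (x ∈_) (sym (concatMap-++ (map var) (map (pos v ∷_) (F₁ l)) _)) (go x∈)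
  where
  F₁-head : ∀ S y → var y ∈ varCS (map (y ∷_) (F₁ S))
  F₁-head leaf y = here refl
  F₁-head (node w l r) y = prepend (F₁ (node w l r)) (F₁-nonempty l)
    where
    F₁-nonempty : ∀ l {z} {ws} → 0 < length (map (z ∷_) (F₁ l) ++ ws)
    F₁-nonempty leaf = s≤s z≤n
    F₁-nonempty (node v l r) {z} {ws} = subst (λ k → 0 < k)
       (sym (trans (length-++ (map (z ∷_) (F₁ (node v l r)))) (cong (_+ length ws) (length-map (z ∷_) (F₁ (node v l r))))))
       (≤-trans (F₁-nonempty l) (m≤m+n _ _))
    prepend : ∀ K → 0 < length K → var y ∈ varCS (map (y ∷_) K)
    prepend (_ ∷ _) _ = here refl
  weaken : ∀ K y → varCS K ⊆ varCS (map (y ∷_) K)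
  weaken (E ∷ K) y p with ∈-++⁻ (map var E) p
  ... | inj₁ q = there (∈-++⁺ˡ q)
  ... | inj₂ q = there (∈-++⁺ʳ (map var E) (weaken K y q))
  go : x ∈ innerLabels (node v l r) → x ∈ varCS (map (pos v ∷_) (F₁ l)) ++ varCS (map (neg v ∷_) (F₁ r))
  go (here refl) = ∈-++⁺ˡ (F₁-head l (pos v))
  go (there p) with ∈-++⁻ (innerLabels l) p
  ... | inj₁ q = ∈-++⁺ˡ (weaken (F₁ l) (pos v) (innerLabels⊆varCS l q))
  ... | inj₂ q = ∈-++⁺ʳ (varCS (map (pos v ∷_) (F₁ l))) (weaken (F₁ r) (neg v) (innerLabels⊆varCS r q))

vars-↭ : ∀ t → innerLabels (skeleton t) ++ leafLabels t ↭ vars t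
vars-↭ (leaf _) = ↭-refl
vars-↭ (node v l r) = prep v (↭-trans
  (++-interchange (innerLabels (skeleton l)) (innerLabels (skeleton r)) (leafLabels l) (leafLabels r))
  (Perm.++⁺ (vars-↭ l) (vars-↭ r)))

doping-Unique : ∀ t → InjectivelyLabelled (skeleton t) → ValidDoping (F₁ (skeleton t)) (leafLabels t) → Unique (vars t)
doping-Unique t inj (_ , uus , fresh) = Unique-resp-↭ (vars-↭ t)
  (Unique.++⁺ inj uus λ { (p , q) → fresh _ q (innerLabels⊆varCS (skeleton t) p) })

Unique-left : ∀ {v l r} → Unique (vars (node v l r)) → Unique (vars l)
Unique-left {v} {l} {r} (_ ∷ u) = AllPairs-resp-⊑ (Sub.++⁺ʳ (vars r) Sub.⊆-refl) u

Unique-right : ∀ {v l r} → Unique (vars (node v l r)) → Unique (vars r)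
Unique-right {v} {l} (_ ∷ u) = AllPairs-resp-⊑ (Sub.++⁺ˡ (vars l) Sub.⊆-refl) u

-- Doped tree clause-sets as decision trees

eval : Assignment → DTree → Bool
eval α (leaf u)     = α u
eval α (node v l r) = if α v then eval α r else eval α l

D-++ : ∀ K K′ us us′ → length K ≡ length us → D (K ++ K′) (us ++ us′) ≡ D K us ++ D K′ us′
D-++ []      K′ []       us′ _ = refl
D-++ (E ∷ K) K′ (u ∷ us) us′ e = cong (_ ∷_) (D-++ K K′ us us′ (suc-injective e))

SatF-D-weaken : ∀ {α} y K us → SatF α (D K us) → SatF α (D (map (y ∷_) K) us)
SatF-D-weaken y []      us []  = []
SatF-D-weaken y (E ∷ K) [] []  = []
SatF-D-weaken y (E ∷ K) (u ∷ us) (here p ∷ ps) = here p ∷ SatF-D-weaken y K us ps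
SatF-D-weaken y (E ∷ K) (u ∷ us) (there p ∷ ps) = there (there p) ∷ SatF-D-weaken y K us ps

SatF-D-strengthen : ∀ {α} y K us → ¬ T (litVal α y) → SatF α (D (map (y ∷_) K) us) → SatF α (D K us)
SatF-D-strengthen y []      us       ¬y ps = []
SatF-D-strengthen y (E ∷ K) []       ¬y ps = []
SatF-D-strengthen y (E ∷ K) (u ∷ us) ¬y (here p ∷ ps)          = here p ∷ SatF-D-strengthen y K us ¬y ps
SatF-D-strengthen y (E ∷ K) (u ∷ us) ¬y (there (here p) ∷ ps)  = contradiction p ¬y
SatF-D-strengthen y (E ∷ K) (u ∷ us) ¬y (there (there p) ∷ ps) = there p ∷ SatF-D-strengthen y K us ¬y ps

SatF-D-satisfied : ∀ {α} y K us → T (litVal α y) → SatF α (D (map (y ∷_) K) us)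
SatF-D-satisfied y []      us       p = []
SatF-D-satisfied y (E ∷ K) []       p = []
SatF-D-satisfied y (E ∷ K) (u ∷ us) p = there (here p) ∷ SatF-D-satisfied y K us p

clauses-node : ∀ v l r → clauses (node v l r) ≡
  D (map (pos v ∷_) (F₁ (skeleton l))) (leafLabels l) ++ D (map (neg v ∷_) (F₁ (skeleton r))) (leafLabels r)
clauses-node v l r = D-++ (map (pos v ∷_) (F₁ (skeleton l))) _ (leafLabels l) _
  (trans (length-map _ (F₁ (skeleton l))) (length-F₁-skeleton l))

-- The assignment falsifies every edge literal on the path it follows, since a true variable sends
-- it right, where the edge is negative. Only the doping variable can then satisfy the clause at the
-- leaf reached.
SatF⇒eval : ∀ {α} t → SatF α (clauses t) → T (eval α t)
SatF⇒eval (leaf u) (here p ∷ []) = p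
SatF⇒eval {α} (node v l r) sat with α v in eq | All.++⁻ (D (map (pos v ∷_) (F₁ (skeleton l))) (leafLabels l)) (subst (SatF α) (clauses-node v l r) sat)
... | true  | _ , q = SatF⇒eval r (SatF-D-strengthen (neg v) (F₁ (skeleton r)) (leafLabels r) (λ p → subst (T ∘ not) eq p) q)
... | false | p , _ = SatF⇒eval l (SatF-D-strengthen (pos v) (F₁ (skeleton l)) (leafLabels l) (λ p → subst T eq p) p)

-- The clause of any other leaf contains the edge literal at which its path departs from the one
-- followed, and this literal is true.
eval⇒SatF : ∀ {α} t → T (eval α t) → SatF α (clauses t)
eval⇒SatF (leaf u) p = here p ∷ []
eval⇒SatF {α} (node v l r) p = subst (SatF α) (sym (clauses-node v l r)) (go (α v) refl p)
  where
  go : ∀ b → α v ≡ b → T (if b then eval α r else eval α l) →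
       SatF α (D (map (pos v ∷_) (F₁ (skeleton l))) (leafLabels l) ++ D (map (neg v ∷_) (F₁ (skeleton r))) (leafLabels r))
  go true  eq q = All.++⁺ (SatF-D-satisfied (pos v) (F₁ (skeleton l)) (leafLabels l) (subst T (sym eq) tt))
                          (SatF-D-weaken (neg v) (F₁ (skeleton r)) (leafLabels r) (eval⇒SatF r q))
  go false eq q = All.++⁺ (SatF-D-weaken (pos v) (F₁ (skeleton l)) (leafLabels l) (eval⇒SatF l q))
                          (SatF-D-satisfied (neg v) (F₁ (skeleton r)) (leafLabels r) (subst (T ∘ not) (sym eq) tt))

-- Prime implicates from leaf sets

_≟ᴸ_ : (x y : Lit) → Dec (x ≡ y)
lit v s ≟ᴸ lit w s′ = map′ (λ { (refl , refl) → refl }) (λ { refl → refl , refl }) ((v ≟ w) ×-dec (s Bool.≟ s′))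

open DecMembership _≟ᴸ_ using (_∈?_)

-- A nonempty set of leaves, together with the subtree it spans.
data Sel : DTree → Set where
  leaf  : ∀ {u} → Sel (leaf u)
  left  : ∀ {v l r} → Sel l → Sel (node v l r)
  right : ∀ {v l r} → Sel r → Sel (node v l r)
  both  : ∀ {v l r} → Sel l → Sel r → Sel (node v l r)

-- The pure literals of the doped clauses at the selected leaves.
clause : ∀ {t} → Sel t → Clause
clause {leaf u}     leaf       = pos u ∷ []
clause {node v _ _} (left a)   = pos v ∷ clause a
clause {node v _ _} (right b)  = neg v ∷ clause b
clause              (both a b) = clause a ++ clause b

-- These are the literals that occur in the doped clauses: doping variables occur only positively.
lits : DTree → List Lit
lits (leaf u)     = pos u ∷ []
lits (node v l r) = pos v ∷ neg v ∷ lits l ++ lits r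

rest : ∀ {t} → Sel t → List Lit
rest leaf                      = []
rest {node v l r} (left a)     = neg v ∷ rest a ++ lits r
rest {node v l r} (right b)    = pos v ∷ lits l ++ rest b
rest {node v l r} (both a b)   = pos v ∷ neg v ∷ rest a ++ rest b

-- As `lits t` has no repetitions, this makes `rest s` repetition-free and disjoint from `clause s`.
clause-rest-↭ : ∀ {t} (s : Sel t) → clause s ++ rest s ↭ lits t
clause-rest-↭ leaf = ↭-refl
clause-rest-↭ {node v l r} (left a) = prep _ (↭-trans (Perm.shift (neg v) (clause a) _)
  (prep _ (↭-trans (↭-reflexive (sym (++-assoc (clause a) (rest a) (lits r))))
                   (Perm.++⁺ʳ (lits r) (clause-rest-↭ a)))))
clause-rest-↭ {node v l r} (right b) = ↭-trans (prep _ (Perm.shift (pos v) (clause b) _)) (swap _ _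
  (↭-trans (Perm.++-comm (clause b) _) (↭-trans (↭-reflexive (++-assoc (lits l) (rest b) (clause b)))
    (Perm.++⁺ˡ (lits l) (↭-trans (Perm.++-comm (rest b) _) (clause-rest-↭ b))))))
clause-rest-↭ {node v l r} (both a b) = ↭-trans (Perm.shift (pos v) (clause a ++ clause b) _)
  (prep _ (↭-trans (Perm.shift (neg v) (clause a ++ clause b) _)
    (prep _ (↭-trans (++-interchange (clause a) (clause b) (rest a) (rest b))
                     (Perm.++⁺ (clause-rest-↭ a) (clause-rest-↭ b))))))

∈lits⇒var∈vars : ∀ t {x} → x ∈ lits t → var x ∈ vars t
∈lits⇒var∈vars (leaf u) (here refl) = here refl
∈lits⇒var∈vars (node v l r) (here refl) = here refl
∈lits⇒var∈vars (node v l r) (there (here refl)) = here refl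
∈lits⇒var∈vars (node v l r) (there (there p)) with ∈-++⁻ (lits l) p
... | inj₁ q = there (∈-++⁺ˡ (∈lits⇒var∈vars l q))
... | inj₂ q = there (∈-++⁺ʳ (vars l) (∈lits⇒var∈vars r q))

lits-Unique : ∀ t → Unique (vars t) → Unique (lits t)
lits-Unique (leaf u) _ = [] ∷ []
lits-Unique (node v l r) u@(v∉ ∷ ulr) =
  ((λ ()) ∷ All.tabulate (λ { p refl → fresh p refl })) ∷ All.tabulate (λ { p refl → fresh p refl }) ∷
  Unique.++⁺ (lits-Unique l (Unique-left {v} {l} {r} u)) (lits-Unique r (Unique-right {v} {l} {r} u))
    (λ { (p , q) → Unique-++⁻-disjoint (vars l) ulr (∈lits⇒var∈vars l p) (∈lits⇒var∈vars r q) })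
  where
  fresh : ∀ {x} → x ∈ lits l ++ lits r → v ≢ var x
  fresh p with ∈-++⁻ (lits l) p
  ... | inj₁ q = All.lookup v∉ (∈-++⁺ˡ (∈lits⇒var∈vars l q))
  ... | inj₂ q = All.lookup v∉ (∈-++⁺ʳ (vars l) (∈lits⇒var∈vars r q))

-- A sublist, not just a subset: distinctness of the variables is inherited, which excludes
-- complementary pairs in the clause.
clause-vars-⊑ : ∀ {t} (s : Sel t) → map var (clause s) ⊑ vars t
clause-vars-⊑ leaf = refl ∷ []
clause-vars-⊑ (left {r = r} a)  = refl ∷ Sub.++⁺ʳ (vars r) (clause-vars-⊑ a)
clause-vars-⊑ (right {l = l} b) = refl ∷ Sub.++⁺ˡ (vars l) (clause-vars-⊑ b)
clause-vars-⊑ (both {v} {l} {r} a b) = v ∷ʳ subst (_⊑ vars l ++ vars r) (sym (map-++ var (clause a) (clause b)))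
  (Sub.++⁺ (clause-vars-⊑ a) (clause-vars-⊑ b))

compl-involutive : ∀ x → compl (compl x) ≡ x
compl-involutive (lit v s) = cong (lit v) (Bool.not-involutive s)

compl≢ : ∀ x → x ≢ compl x
compl≢ (lit v true) ()
compl≢ (lit v false) ()

clause-IsClause : ∀ {t} → Unique (vars t) → (s : Sel t) → IsClause (clause s)
clause-IsClause u s x p q = compl≢ x
  (map-Unique-injective var (AllPairs-resp-⊑ (clause-vars-⊑ s) u) p q refl)

rest∩clause : ∀ {t} → Unique (vars t) → (s : Sel t) → ∀ {x} → x ∈ clause s → x ∉ rest s
rest∩clause {t} u s = Unique-++⁻-disjoint (clause s) (Unique-resp-↭ (↭-sym (clause-rest-↭ s)) (lits-Unique t u))

rest-Unique : ∀ {t} → Unique (vars t) → (s : Sel t) → Unique (rest s)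
rest-Unique {t} u s = AllPairs-resp-⊑ (Sub.++⁺ˡ (clause s) Sub.⊆-refl) (Unique-resp-↭ (↭-sym (clause-rest-↭ s)) (lits-Unique t u))

-- Either the path followed ends at a selected leaf, whose doping variable is true, or it leaves the
-- spanned subtree at a one-sided node, and there the pure literal of that node is true.
eval⇒SatC-clause : ∀ {α t} (s : Sel t) → T (eval α t) → SatC α (clause s)
eval⇒SatC-clause leaf p = here p
eval⇒SatC-clause {α} {node v l r} (left a) p with α v in eq
... | true  = here (subst T (sym eq) tt)
... | false = there (eval⇒SatC-clause a p)
eval⇒SatC-clause {α} {node v l r} (right b) p with α v in eq
... | true  = there (eval⇒SatC-clause b p)
... | false = here (subst (T ∘ not) (sym eq) tt)
eval⇒SatC-clause {α} {node v l r} (both a b) p with α v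
... | true  = Any.++⁺ʳ (clause a) (eval⇒SatC-clause b p)
... | false = Any.++⁺ˡ (eval⇒SatC-clause a p)

-- Implicates and primality

-- E clashes with the path to every leaf whose doping variable is not in E.
Imp : Clause → DTree → Set
Imp E (leaf u)     = pos u ∈ E
Imp E (node v l r) = (neg v ∈ E ⊎ Imp E l) × (pos v ∈ E ⊎ Imp E r)

-- For a clause E this is φ_E, completed by β to a total assignment.
falsify : Clause → Assignment → Assignment
falsify E β v with neg v ∈? E | pos v ∈? E
... | yes _ | _     = true
... | no _  | yes _ = false
... | no _  | no _  = β v

falsify-falsifies : ∀ {E} β → IsClause E → ¬ SatC (falsify E β) E
falsify-falsifies {E} β isC sat with find sat
... | lit v true , x∈ , p with neg v ∈? E | pos v ∈? E
...   | yes q | _     = isC _ x∈ q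
...   | no _  | no ¬q = ¬q x∈
falsify-falsifies {E} β isC sat | lit v false , x∈ , p with neg v ∈? E | pos v ∈? E
...   | no ¬q | _ = ¬q x∈

falsify-neg : ∀ {E v} β → neg v ∉ E → β v ≡ false → falsify E β v ≡ false
falsify-neg {E} {v} β ¬n eq with neg v ∈? E | pos v ∈? E
... | yes n | _     = contradiction n ¬n
... | no _  | yes _ = refl
... | no _  | no _  = eq

falsify-pos : ∀ {E v} β → pos v ∉ E → β v ≡ true → falsify E β v ≡ true
falsify-pos {E} {v} β ¬p eq with neg v ∈? E | pos v ∈? E
... | yes _ | _     = refl
... | no _  | yes p = contradiction p ¬p
... | no _  | no _  = eq

falsify-cong : ∀ {E v β β′} → β v ≡ β′ v → falsify E β v ≡ falsify E β′ v
falsify-cong {E} {v} eq with neg v ∈? E | pos v ∈? E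
... | yes _ | _     = refl
... | no _  | yes _ = refl
... | no _  | no _  = eq

eval-false : ∀ {α v} l r → α v ≡ false → eval α (node v l r) ≡ eval α l
eval-false l r eq rewrite eq = refl

eval-true : ∀ {α v} l r → α v ≡ true → eval α (node v l r) ≡ eval α r
eval-true l r eq rewrite eq = refl

eval-cong : ∀ {α β} t → (∀ {v} → v ∈ vars t → α v ≡ β v) → eval α t ≡ eval β t
eval-cong (leaf u) h = h (here refl)
eval-cong {β = β} (node v l r) h rewrite h (here refl) with β v
... | true  = eval-cong r (λ p → h (there (∈-++⁺ʳ (vars l) p)))
... | false = eval-cong l (λ p → h (there (∈-++⁺ˡ p)))

_[_≔_] : Assignment → ℕ → Bool → Assignment
(β [ v ≔ b ]) w with v ≟ w
... | yes _ = b
... | no _  = β w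

≔-same : ∀ β v b → (β [ v ≔ b ]) v ≡ b
≔-same β v b with v ≟ v
... | yes _ = refl
... | no v≢v = contradiction refl v≢v

≔-other : ∀ β v b {w} → v ≢ w → (β [ v ≔ b ]) w ≡ β w
≔-other β v b {w} v≢w with v ≟ w
... | yes v≡w = contradiction v≡w v≢w
... | no _    = refl

-- If E lacks `neg v`, the completion of φ_E may set v to false, which leads into the left subtree;
-- so falsity of the whole tree descends there. The right side is symmetric.
falsified⇒Imp : ∀ {E} t → Unique (vars t) → (∀ β → ¬ T (eval (falsify E β) t)) → Imp E t
falsified⇒Imp {E} (leaf u) _ h = decidable-stable (pos u ∈? E) λ ¬p →
  h (λ _ → true) (subst T (sym (falsify-pos {E} {u} (λ _ → true) ¬p refl)) tt)
falsified⇒Imp {E} (node v l r) un@(v∉ ∷ _) h = goˡ , goʳ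
  where
  -- The root variable does not recur below, so overriding it leaves the value of a subtree
  -- unchanged.
  branch : ∀ β b t → vars t ⊆ vars l ++ vars r →
           eval (falsify E (β [ v ≔ b ])) t ≡ eval (falsify E β) t
  branch β b t ⊆lr = eval-cong t (λ p → falsify-cong {E} (≔-other β v b (All.lookup v∉ (⊆lr p))))
  goˡ : neg v ∈ E ⊎ Imp E l
  goˡ = Sum.map₂ (λ ¬p → falsified⇒Imp l (Unique-left {v} {l} {r} un) λ β p → h (β [ v ≔ false ])
    (subst T (sym (trans (eval-false l r (falsify-neg (β [ v ≔ false ]) ¬p (≔-same β v false))) (branch β false l ∈-++⁺ˡ))) p))
    (toSum (neg v ∈? E))
  goʳ : pos v ∈ E ⊎ Imp E r
  goʳ = Sum.map₂ (λ ¬p → falsified⇒Imp r (Unique-right {v} {l} {r} un) λ β p → h (β [ v ≔ true ])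
    (subst T (sym (trans (eval-true l r (falsify-pos (β [ v ≔ true ]) ¬p (≔-same β v true))) (branch β true r (∈-++⁺ʳ (vars l))))) p))
    (toSum (pos v ∈? E))

⊨⇒Imp : ∀ {E} t → Unique (vars t) → IsClause E → clauses t ⊨ E → Imp E t
⊨⇒Imp t u isC F⊨E = falsified⇒Imp t u λ β p → falsify-falsifies β isC (F⊨E _ (eval⇒SatF t p))

-- Quantifying over the literals of the word, not over those of E, lets the condition decompose
-- along the tree together with `clause`.
NoClash : ∀ {t} → Clause → Sel t → Set
NoClash E s = All (λ x → compl x ∉ E) (clause s)

-- Descend to the left until E contains a negative edge literal; failing that, it contains the
-- doping variable of the leftmost leaf.
Imp⇒meets-lits : ∀ {E} t → Imp E t → ¬ All (_∉ E) (lits t)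
Imp⇒meets-lits (leaf u) p (¬p ∷ _) = ¬p p
Imp⇒meets-lits (node v l r) (inj₁ p , _) (_ ∷ ¬p ∷ _) = ¬p p
Imp⇒meets-lits (node v l r) (inj₂ p , _) (_ ∷ _ ∷ ¬p) = Imp⇒meets-lits l p (All.++⁻ˡ _ ¬p)

-- At a one-sided node the omitted subtree belongs to `rest s`, so E cannot satisfy `Imp` there and
-- must contain the pure literal. On the selected side the alternative of an edge literal in E is
-- excluded by `NoClash`, or at a two-sided node by `rest s`; so the argument descends to the
-- selected leaves.
Imp⇒clause⊆ : ∀ {E t} (s : Sel t) → Imp E t → NoClash E s → All (_∉ E) (rest s) → All (_∈ E) (clause s)
Imp⇒clause⊆ leaf p _ _ = p ∷ []
Imp⇒clause⊆ (left {r = r} a) (p , q) (nc ∷ ncs) (_ ∷ cs) = q′ ∷ Imp⇒clause⊆ a p′ ncs (All.++⁻ˡ _ cs)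
  where
  p′ = [ (λ n → contradiction n nc) , id ]′ p
  q′ = [ id , (λ i → contradiction (All.++⁻ʳ (rest a) cs) (Imp⇒meets-lits r i)) ]′ q
Imp⇒clause⊆ (right {l = l} b) (p , q) (nc ∷ ncs) (_ ∷ cs) = p′ ∷ Imp⇒clause⊆ b q′ ncs (All.++⁻ʳ (lits l) cs)
  where
  q′ = [ (λ n → contradiction n nc) , id ]′ q
  p′ = [ id , (λ i → contradiction (All.++⁻ˡ (lits l) cs) (Imp⇒meets-lits l i)) ]′ p
Imp⇒clause⊆ (both a b) (p , q) ncs (c₁ ∷ c₂ ∷ cs) =
  All.++⁺ (Imp⇒clause⊆ a p′ (All.++⁻ˡ _ ncs) (All.++⁻ˡ _ cs))
          (Imp⇒clause⊆ b q′ (All.++⁻ʳ (clause a) ncs) (All.++⁻ʳ (rest a) cs))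
  where
  p′ = [ (λ n → contradiction n c₂) , id ]′ p
  q′ = [ (λ n → contradiction n c₁) , id ]′ q

-- An implicate contained in `clause s` neither clashes with it nor meets `rest s`, so `Imp⇒clause⊆`
-- yields the reverse inclusion.
clause-IsPrimeImplicate : ∀ {t} → Unique (vars t) → (s : Sel t) → IsPrimeImplicate (clauses t) (clause s)
clause-IsPrimeImplicate {t} u s = isC , (λ α sat → eval⇒SatC-clause s (SatF⇒eval t sat)) ,
  λ E isE E⊆ F⊨E → All.lookup (Imp⇒clause⊆ s (⊨⇒Imp t u isE F⊨E)
    (All.tabulate (λ {x} x∈ q → isC x x∈ (E⊆ q)))
    (All.tabulate (λ x∈ q → rest∩clause u s (E⊆ q) x∈)))
  where isC = clause-IsClause u s

-- Taken over `rest s`, this bounds the number of literals of E outside `clause s` from below, and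
-- it is additive over subtrees.
excess : Clause → List Lit → ℕ
excess E xs = length (filter (_∈? E) xs)

excess-++ : ∀ E xs ys → excess E (xs ++ ys) ≡ excess E xs + excess E ys
excess-++ E xs ys = trans (cong length (filter-++ (_∈? E) xs ys)) (length-++ (filter (_∈? E) xs))

excess-some : ∀ E xs {x} → x ∈ xs → x ∈ E → 1 ≤ excess E xs
excess-some E xs x∈xs x∈E = filter-some (_∈? E) (lose x∈xs x∈E)

excess≤0⇒All∉ : ∀ {E} xs → excess E xs ≤ 0 → All (_∉ E) xs
excess≤0⇒All∉ xs p = All.¬Any⇒All¬ xs (λ q → contradiction (≤-trans (filter-some (_∈? _) q) p) λ ())

excess≤CardDiff : ∀ {E t k} → Unique (vars t) → (s : Sel t) → CardDiff≤ E (clause s) k → excess E (rest s) ≤ k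
excess≤CardDiff {E} u s (L , len , cover) = ≤-trans
  (Unique-⊆⇒length≤ (Unique.filter⁺ (_∈? E) (rest-Unique u s))
     λ x∈ → let (x∈rest , x∈E) = ∈-filter⁻ (_∈? E) x∈ in cover _ x∈E (λ p → rest∩clause u s p x∈rest)) len

module ℕ∈ = DecMembership _≟_

-- Codes

excess-∷ : ∀ E x xs → excess E xs ≤ excess E (x ∷ xs)
excess-∷ E x xs with x ∈? E
... | yes _ = n≤1+n _
... | no _  = ≤-refl

excess-accept : ∀ {E x} xs → x ∈ E → excess E (x ∷ xs) ≡ suc (excess E xs)
excess-accept {E} xs p = cong length (filter-accept (_∈? E) {xs = xs} p)

excess-mono : ∀ {E E′} xs → E ⊆ E′ → excess E xs ≤ excess E′ xs
excess-mono [] _ = z≤n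
excess-mono {E} {E′} (x ∷ xs) E⊆ with x ∈? E | x ∈? E′
... | yes _ | yes _ = s≤s (excess-mono xs E⊆)
... | yes p | no ¬q = contradiction (E⊆ p) ¬q
... | no _  | yes _ = m≤n⇒m≤1+n (excess-mono xs E⊆)
... | no _  | no _  = excess-mono xs E⊆

NoClash-anti : ∀ {E E′ t} (s : Sel t) → E ⊆ E′ → NoClash E′ s → NoClash E s
NoClash-anti _ E⊆ = All.map (_∘ E⊆)

excess-++-mono : ∀ {E₁ E₂ E} xs ys → E₁ ⊆ E → E₂ ⊆ E → excess E₁ xs + excess E₂ ys ≤ excess E (xs ++ ys)
excess-++-mono {E = E} xs ys ⊆₁ ⊆₂ = ≤-trans (+-mono-≤ (excess-mono xs ⊆₁) (excess-mono ys ⊆₂))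
  (≤-reflexive (sym (excess-++ E xs ys)))

excess-∷-++-mono : ∀ {E₁ E₂} E x xs ys → E₁ ⊆ E → E₂ ⊆ E → excess E₁ xs + excess E₂ ys ≤ excess E (x ∷ xs ++ ys)
excess-∷-++-mono E x xs ys ⊆₁ ⊆₂ = ≤-trans (excess-++-mono xs ys ⊆₁ ⊆₂) (excess-∷ E x (xs ++ ys))

excess-∷-++ˡ : ∀ {E₁} E x xs ys → E₁ ⊆ E → excess E₁ xs ≤ excess E (x ∷ xs ++ ys)
excess-∷-++ˡ E x xs ys ⊆₁ = ≤-trans (m≤m+n _ (excess E ys)) (excess-∷-++-mono E x xs ys ⊆₁ id)

excess-∷-++ʳ : ∀ {E₂} E x xs ys → E₂ ⊆ E → excess E₂ ys ≤ excess E (x ∷ xs ++ ys)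
excess-∷-++ʳ E x xs ys ⊆₂ = ≤-trans (m≤n+m _ (excess E xs)) (excess-∷-++-mono E x xs ys id ⊆₂)

excess-both : ∀ {v l r} (a₁ : Sel l) (a₂ : Sel r) (b₁ : Sel l) (b₂ : Sel r) →
  excess (clause a₁) (rest b₁) + excess (clause a₂) (rest b₂) ≤ excess (clause (both {v} a₁ a₂)) (rest (both {v} b₁ b₂))
excess-both {v} a₁ a₂ b₁ b₂ =
  ≤-trans (excess-∷-++-mono E (neg v) (rest b₁) (rest b₂) ∈-++⁺ˡ (∈-++⁺ʳ (clause a₁))) (excess-∷ E (pos v) (neg v ∷ rest b₁ ++ rest b₂))
  where E = clause a₁ ++ clause a₂

NoClash-bothˡ : ∀ {v l r} (a₁ : Sel l) (a₂ : Sel r) (b₁ : Sel l) (b₂ : Sel r) →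
  NoClash (clause (both {v} a₁ a₂)) (both {v} b₁ b₂) → NoClash (clause a₁) b₁
NoClash-bothˡ a₁ a₂ b₁ b₂ nc = NoClash-anti b₁ ∈-++⁺ˡ (All.++⁻ˡ (clause b₁) nc)

NoClash-bothʳ : ∀ {v l r} (a₁ : Sel l) (a₂ : Sel r) (b₁ : Sel l) (b₂ : Sel r) →
  NoClash (clause (both {v} a₁ a₂)) (both {v} b₁ b₂) → NoClash (clause a₂) b₂
NoClash-bothʳ a₁ a₂ b₁ b₂ nc = NoClash-anti b₂ (∈-++⁺ʳ (clause a₁)) (All.++⁻ʳ (clause b₁) nc)

excess-both-split : ∀ E {v l r} (a : Sel l) (b : Sel r) → excess E (rest a) + excess E (rest b) ≤ excess E (rest (both {v} a b))
excess-both-split E {v} a b = ≤-trans (≤-reflexive (sym (excess-++ E (rest a) (rest b))))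
  (≤-trans (excess-∷ E (neg v) _) (excess-∷ E (pos v) _))

record Code (k : ℕ) (t : DTree) (N : ℕ) : Set where
  field
    word     : Fin N → Sel t
    apart    : ∀ {i j} → i ≢ j → NoClash (clause (word i)) (word j) →
               suc (suc k) ≤ excess (clause (word i)) (rest (word j))
    disjoint : ∀ {i j} → i ≢ j → ∀ {E} → IsClause E → Imp E t →
               NoClash E (word i) → NoClash E (word j) →
               excess E (rest (word i)) ≤ k → excess E (rest (word j)) ≤ k → ⊥

open Code

Code-node : ∀ {k v l r N} → Code k l N → Code k r N → Code (suc k) (node v l r) N
Code-node {k} {v} {l} {r} {N} cl cr = record { word = w ; apart = far ; disjoint = disj }
  where
  a = word cl
  b = word cr
  w : Fin N → Sel (node v l r)
  w i = both (a i) (b i)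
  far : ∀ {i j} → i ≢ j → NoClash (clause (w i)) (w j) → 3 + k ≤ excess (clause (w i)) (rest (w j))
  far {i} {j} i≢j nc = begin
    3 + k                     ≤⟨ s≤s (s≤s (m≤n+m (suc k) (suc k))) ⟩
    2 + (suc k + suc k)       ≡⟨ cong suc (+-suc (suc k) (suc k)) ⟨
    suc (suc k) + suc (suc k) ≤⟨ +-mono-≤ (apart cl i≢j (NoClash-bothˡ {v} (a i) (b i) (a j) (b j) nc))
                                          (apart cr i≢j (NoClash-bothʳ {v} (a i) (b i) (a j) (b j) nc)) ⟩
    excess (clause (a i)) (rest (a j)) + excess (clause (b i)) (rest (b j)) ≤⟨ excess-both (a i) (b i) (a j) (b j) ⟩
    excess (clause (w i)) (rest (w j)) ∎
    where open ≤-Reasoning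

  module _ {E} (isC : IsClause E) where
    sum≤ : ∀ i → excess E (rest (w i)) ≤ suc k → excess E (rest (a i)) + excess E (rest (b i)) ≤ suc k
    sum≤ i = ≤-trans (excess-both-split E (a i) (b i))

    -- Words selecting on both sides omit the root variable, so a root literal in E uses up one unit
    -- of the excess.
    pure≤ : ∀ {y i} → y ∈ E → y ∈ pos v ∷ neg v ∷ [] → excess E (rest (w i)) ≤ suc k → excess E (rest (a i)) + excess E (rest (b i)) ≤ k
    pure≤ {y} {i} y∈ y∈v e = s≤s⁻¹ (≤-trans (helper y∈v) e)
      where
      lr = rest (a i) ++ rest (b i)
      helper : y ∈ pos v ∷ neg v ∷ [] → suc (excess E (rest (a i)) + excess E (rest (b i))) ≤ excess E (pos v ∷ neg v ∷ lr)
      helper q rewrite sym (excess-++ E (rest (a i)) (rest (b i))) with q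
      ... | here refl = ≤-trans (s≤s (excess-∷ E (neg v) lr)) (≤-reflexive (sym (excess-accept (neg v ∷ lr) y∈)))
      ... | there (here refl) = ≤-trans (≤-reflexive (sym (excess-accept lr y∈))) (excess-∷ E (pos v) (neg v ∷ lr))

    -- Excess 0 puts the left word j inside E. The excess of E against the left word i is then at
    -- least that of word j, which is k + 2.
    cross : ∀ {i j} → i ≢ j → Imp E l → NoClash E (w i) → NoClash E (w j) →
            excess E (rest (a i)) ≤ suc k → excess E (rest (a j)) ≤ 0 → ⊥
    cross {i} {j} i≢j impˡ nci ncj ei ej = <-irrefl refl (begin-strict
      suc k                                <⟨ n<1+n (suc k) ⟩
      suc (suc k)                          ≤⟨ apart cl (i≢j ∘ sym) (NoClash-anti (a i) aj⊆E (All.++⁻ˡ (clause (a i)) nci)) ⟩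
      excess (clause (a j)) (rest (a i))   ≤⟨ excess-mono (rest (a i)) aj⊆E ⟩
      excess E (rest (a i))                ≤⟨ ei ⟩
      suc k ∎)
      where
      open ≤-Reasoning
      aj⊆E : clause (a j) ⊆ E
      aj⊆E = All.lookup (Imp⇒clause⊆ (a j) impˡ (All.++⁻ˡ (clause (a j)) ncj) (excess≤0⇒All∉ (rest (a j)) ej))

    split : ∀ {x y} → k < x → x + y ≤ suc k → x ≤ suc k × y ≤ 0
    split {x} {y} k<x e = ≤-trans (m≤m+n x y) e , +-cancelˡ-≤ (suc k) y 0 (≤-trans (+-monoˡ-≤ y k<x) (≤-trans e (≤-reflexive (sym (+-identityʳ (suc k))))))

    -- Word i spends its whole allowance k + 1 on the left and has excess 0 on the right. If word j
    -- stays within k on the right, the right code applies; otherwise word j has excess 0 on the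
    -- left, and `cross` applies.
    two-sided : ∀ {i j} → i ≢ j → Imp E l → Imp E r → NoClash E (w i) → NoClash E (w j) →
            excess E (rest (a i)) + excess E (rest (b i)) ≤ suc k →
            excess E (rest (a j)) + excess E (rest (b j)) ≤ suc k →
            k < excess E (rest (a i)) → ⊥
    two-sided {i} {j} i≢j impˡ impʳ nci ncj ei ej k<ai with split k<ai ei
    ... | ai≤ , bi≤0 with excess E (rest (b j)) ≤? k
    ...   | yes bj≤k = disjoint cr i≢j isC impʳ (All.++⁻ʳ (clause (a i)) nci) (All.++⁻ʳ (clause (a j)) ncj) (≤-trans bi≤0 z≤n) bj≤k
    ...   | no bj≰k  = cross i≢j impˡ nci ncj ai≤
                         (proj₂ (split (≰⇒> bj≰k) (≤-trans (≤-reflexive (+-comm (excess E (rest (b j))) _)) ej)))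

  disj : ∀ {i j} → i ≢ j → ∀ {E} → IsClause E → Imp E (node v l r) → NoClash E (w i) → NoClash E (w j) →
         excess E (rest (w i)) ≤ suc k → excess E (rest (w j)) ≤ suc k → ⊥
  -- E would contain both literals of the root variable.
  disj i≢j isC (inj₁ p , inj₁ q) nci ncj ei ej = isC _ p q
  -- Here `Imp` is available on the right, and the root literal in E lowers the bound there from k +
  -- 1 to k.
  disj {i} {j} i≢j isC (inj₁ p , inj₂ q) nci ncj ei ej =
    disjoint cr i≢j isC q (All.++⁻ʳ (clause (a i)) nci) (All.++⁻ʳ (clause (a j)) ncj)
      (m+n≤o⇒n≤o _ (pure≤ isC {i = i} p (there (here refl)) ei)) (m+n≤o⇒n≤o _ (pure≤ isC {i = j} p (there (here refl)) ej))
  disj {i} {j} i≢j isC (inj₂ p , inj₁ q) nci ncj ei ej =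
    disjoint cl i≢j isC p (All.++⁻ˡ (clause (a i)) nci) (All.++⁻ˡ (clause (a j)) ncj)
      (m+n≤o⇒m≤o _ (pure≤ isC {i = i} q (here refl) ei)) (m+n≤o⇒m≤o _ (pure≤ isC {i = j} q (here refl) ej))
  -- The left code settles the case where both left excesses are at most k; otherwise one of the
  -- words spends its whole allowance on the left.
  disj {i} {j} i≢j {E} isC (inj₂ p , inj₂ q) nci ncj ei ej with excess E (rest (a i)) ≤? k | excess E (rest (a j)) ≤? k
  ... | yes ai≤ | yes aj≤ = disjoint cl i≢j isC p (All.++⁻ˡ (clause (a i)) nci) (All.++⁻ˡ (clause (a j)) ncj) ai≤ aj≤
  ... | no ai≰  | _       = two-sided isC i≢j p q nci ncj (sum≤ isC i ei) (sum≤ isC j ej) (≰⇒> ai≰)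
  ... | yes _   | no aj≰  = two-sided isC (i≢j ∘ sym) p q ncj nci (sum≤ isC j ej) (sum≤ isC i ei) (≰⇒> aj≰)

-- Leaf sets and the distance between their clauses

Selects : ∀ {t} → (ℕ → Set) → Sel t → Set
Selects {leaf u}     P leaf             = P u
Selects              P (left {r = r} a)  = Selects P a × All (¬_ ∘ P) (leafLabels r)
Selects              P (right {l = l} b) = All (¬_ ∘ P) (leafLabels l) × Selects P b
Selects              P (both a b)        = Selects P a × Selects P b

select : ∀ {P} → Decidable P → ∀ t → (∃ λ (s : Sel t) → Selects P s) ⊎ All (¬_ ∘ P) (leafLabels t)
select P? (leaf u) with P? u
... | yes p = inj₁ (leaf , p)
... | no ¬p = inj₂ (¬p ∷ [])
select P? (node v l r) with select P? l | select P? r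
... | inj₁ (a , p) | inj₁ (b , q) = inj₁ (both a b , p , q)
... | inj₁ (a , p) | inj₂ q       = inj₁ (left a , p , q)
... | inj₂ p       | inj₁ (b , q) = inj₁ (right b , p , q)
... | inj₂ p       | inj₂ q       = inj₂ (All.++⁺ p q)

All¬⇒¬Any× : ∀ {P R : ℕ → Set} {us} {A : Set} → All (¬_ ∘ P) us → Any (λ u → P u × R u) us → A
All¬⇒¬Any× ¬ps p = contradiction (Any.map proj₁ p) (All.All¬⇒¬Any ¬ps)

-- Used where one selection enters a subtree that the other omits: all literals of that subtree then
-- lie in the `rest` of the other.
excess-clause-lits : ∀ {t} {E} (s : Sel t) → clause s ⊆ E → 1 ≤ excess E (lits t)
excess-clause-lits {t} {E} s ⊆E with clause s in eq | clause-rest-↭ s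
... | x ∷ _ | p = excess-some E (lits t) (Perm.∈-resp-↭ p (here refl)) (⊆E (here refl))
... | [] | p = ⊥-elim (clause-nonempty s eq)
  where
  clause-nonempty : ∀ {t} (s : Sel t) → clause s ≢ []
  clause-nonempty (both a b) e = clause-nonempty a (++-conicalˡ (clause a) (clause b) e)

module _ {P Q : ℕ → Set} where

  Differ : List ℕ → Set
  Differ us = Any (λ u → P u × ¬ Q u) us ⊎ Any (λ u → Q u × ¬ P u) us

  Differ-++⁻ : ∀ us {ws} → Differ (us ++ ws) → Differ us ⊎ Differ ws
  Differ-++⁻ us (inj₁ d) = Sum.map inj₁ inj₁ (Any.++⁻ us d)
  Differ-++⁻ us (inj₂ d) = Sum.map inj₂ inj₂ (Any.++⁻ us d)

  ¬Differ : ∀ {us} → All (¬_ ∘ P) us → All (¬_ ∘ Q) us → {A : Set} → Differ us → A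
  ¬Differ ¬p ¬q = [ All¬⇒¬Any× ¬p , All¬⇒¬Any× ¬q ]′

  -- Two selections that branch alike everywhere select the same leaves. Where they first branch
  -- differently in the direction of a differing leaf, either opposite sides clash, or the one-sided
  -- node contributes its pure literal, or the extra subtree of the two-sided node contributes a
  -- literal.
  1≤excess : ∀ {t} (a b : Sel t) → Selects P a → Selects Q b → NoClash (clause a) b →
             Differ (leafLabels t) → 1 ≤ excess (clause a) (rest b)
  1≤excess leaf leaf p q nc (inj₁ (here (_ , ¬q))) = contradiction q ¬q
  1≤excess leaf leaf p q nc (inj₂ (here (_ , ¬p))) = contradiction p ¬p
  1≤excess {node v l r} (left a) (left b) (p , ¬p) (q , ¬q) (_ ∷ nc) d =
    ≤-trans (1≤excess a b p q (NoClash-anti b there nc) ([ id , ¬Differ ¬p ¬q ]′ (Differ-++⁻ (leafLabels l) d)))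
      (excess-∷-++ˡ (pos v ∷ clause a) (neg v) (rest b) (lits r) there)
  1≤excess {node v l r} (right a) (right b) (¬p , p) (¬q , q) (_ ∷ nc) d =
    ≤-trans (1≤excess a b p q (NoClash-anti b there nc) ([ ¬Differ ¬p ¬q , id ]′ (Differ-++⁻ (leafLabels l) d)))
      (excess-∷-++ʳ (neg v ∷ clause a) (pos v) (lits l) (rest b) there)
  1≤excess (left a) (right b) _ _ (nc ∷ _) _ = contradiction (here refl) nc
  1≤excess (right a) (left b) _ _ (nc ∷ _) _ = contradiction (here refl) nc
  1≤excess {node v l r} (left a) (both b₁ b₂) _ _ _ _ = excess-some (pos v ∷ clause a) (pos v ∷ neg v ∷ rest b₁ ++ rest b₂) (here refl) (here refl)
  1≤excess {node v l r} (right a) (both b₁ b₂) _ _ _ _ = excess-some (neg v ∷ clause a) (pos v ∷ neg v ∷ rest b₁ ++ rest b₂) (there (here refl)) (here refl)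
  1≤excess {node v l r} (both a₁ a₂) (left b) _ _ _ _ = ≤-trans (excess-clause-lits a₂ id) (excess-∷-++ʳ (clause a₁ ++ clause a₂) (neg v) (rest b) (lits r) (∈-++⁺ʳ (clause a₁)))
  1≤excess {node v l r} (both a₁ a₂) (right b) _ _ _ _ = ≤-trans (excess-clause-lits a₁ id) (excess-∷-++ˡ (clause a₁ ++ clause a₂) (pos v) (lits l) (rest b) ∈-++⁺ˡ)
  1≤excess {node v l r} (both a₁ a₂) (both b₁ b₂) (p₁ , p₂) (q₁ , q₂) nc d =
    ≤-trans ([ (λ e → ≤-trans (1≤excess a₁ b₁ p₁ q₁ (NoClash-bothˡ {v} a₁ a₂ b₁ b₂ nc) e) (m≤m+n _ (excess (clause a₂) (rest b₂))))
             , (λ e → ≤-trans (1≤excess a₂ b₂ p₂ q₂ (NoClash-bothʳ {v} a₁ a₂ b₁ b₂ nc) e) (m≤n+m _ (excess (clause a₁) (rest b₁)))) ]′ (Differ-++⁻ (leafLabels l) d))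
      (excess-both a₁ a₂ b₁ b₂)

-- Besides the doping variable of a leaf in P ∖ Q, clause a contains a branching literal not in clause b.
2≤excess : ∀ {P Q t} (a b : Sel t) → Selects P a → Selects Q b → NoClash (clause a) b →
           Any (λ u → P u × ¬ Q u) (leafLabels t) → Any (λ u → Q u × ¬ P u) (leafLabels t) →
           2 ≤ excess (clause a) (rest b)
2≤excess leaf leaf p q _ (here (_ , ¬q)) _ = contradiction q ¬q
2≤excess {t = node v l r} (left a) (left b) (p , ¬p) (q , ¬q) (_ ∷ nc) d e =
  ≤-trans (2≤excess a b p q (NoClash-anti b there nc)
             ([ id , All¬⇒¬Any× ¬p ]′ (Any.++⁻ (leafLabels l) d))
             ([ id , All¬⇒¬Any× ¬q ]′ (Any.++⁻ (leafLabels l) e)))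
    (excess-∷-++ˡ (pos v ∷ clause a) (neg v) (rest b) (lits r) there)
2≤excess {t = node v l r} (right a) (right b) (¬p , p) (¬q , q) (_ ∷ nc) d e =
  ≤-trans (2≤excess a b p q (NoClash-anti b there nc)
             ([ All¬⇒¬Any× ¬p , id ]′ (Any.++⁻ (leafLabels l) d))
             ([ All¬⇒¬Any× ¬q , id ]′ (Any.++⁻ (leafLabels l) e)))
    (excess-∷-++ʳ (neg v ∷ clause a) (pos v) (lits l) (rest b) there)
2≤excess (left a) (right b) _ _ (nc ∷ _) _ _ = contradiction (here refl) nc
2≤excess (right a) (left b) _ _ (nc ∷ _) _ _ = contradiction (here refl) nc
-- `pos v` counts once. The leaf in P outside Q lies on the left, since a selects nothing on the
-- right, and yields the second literal.
2≤excess {P} {Q} {t = node v l r} (left a) (both b₁ b₂) (p , ¬p) (q , _) nc d e =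
  ≤-trans (s≤s (≤-trans
    (1≤excess {P} {Q} a b₁ p q (NoClash-anti b₁ there (All.++⁻ˡ (clause b₁) nc)) (inj₁ ([ id , All¬⇒¬Any× ¬p ]′ (Any.++⁻ (leafLabels l) d))))
    (excess-∷-++ˡ (pos v ∷ clause a) (neg v) (rest b₁) (rest b₂) there)))
    (≤-reflexive (sym (excess-accept (neg v ∷ rest b₁ ++ rest b₂) (here refl))))
2≤excess {P} {Q} {t = node v l r} (right a) (both b₁ b₂) (¬p , p) (_ , q) nc d e =
  ≤-trans (s≤s (≤-trans
    (1≤excess {P} {Q} a b₂ p q (NoClash-anti b₂ there (All.++⁻ʳ (clause b₁) nc)) (inj₁ ([ All¬⇒¬Any× ¬p , id ]′ (Any.++⁻ (leafLabels l) d))))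
    (≤-trans (excess-mono (rest b₂) there) (≤-trans (m≤n+m _ (excess E (rest b₁))) (≤-reflexive (sym (excess-++ E (rest b₁) (rest b₂))))))))
    (≤-trans (≤-reflexive (sym (excess-accept (rest b₁ ++ rest b₂) (here refl)))) (excess-∷ E (pos v) (neg v ∷ rest b₁ ++ rest b₂)))
  where E = neg v ∷ clause a
-- The omitted right subtree yields one literal. The leaf in P outside Q may lie there too, so the
-- difference on the left comes from the leaf in Q outside P.
2≤excess {P} {Q} {t = node v l r} (both a₁ a₂) (left b) (p , _) (q , ¬q) (_ ∷ nc) d e =
  ≤-trans (+-mono-≤ (1≤excess {P} {Q} a₁ b p q (NoClash-anti b ∈-++⁺ˡ nc) (inj₂ ([ id , All¬⇒¬Any× ¬q ]′ (Any.++⁻ (leafLabels l) e))))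
                    (excess-clause-lits a₂ id))
    (excess-∷-++-mono (clause a₁ ++ clause a₂) (neg v) (rest b) (lits r) ∈-++⁺ˡ (∈-++⁺ʳ (clause a₁)))
2≤excess {P} {Q} {t = node v l r} (both a₁ a₂) (right b) (_ , p) (¬q , q) (_ ∷ nc) d e =
  ≤-trans (+-mono-≤ (excess-clause-lits a₁ id)
                    (1≤excess {P} {Q} a₂ b p q (NoClash-anti b (∈-++⁺ʳ (clause a₁)) nc) (inj₂ ([ All¬⇒¬Any× ¬q , id ]′ (Any.++⁻ (leafLabels l) e)))))
    (excess-∷-++-mono (clause a₁ ++ clause a₂) (pos v) (lits l) (rest b) ∈-++⁺ˡ (∈-++⁺ʳ (clause a₁)))
2≤excess {P} {Q} {t = node v l r} (both a₁ a₂) (both b₁ b₂) (p₁ , p₂) (q₁ , q₂) nc d e = ≤-trans total (excess-both a₁ a₂ b₁ b₂)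
  where
  ncˡ = NoClash-bothˡ {v} a₁ a₂ b₁ b₂ nc
  ncʳ = NoClash-bothʳ {v} a₁ a₂ b₁ b₂ nc
  total : 2 ≤ excess (clause a₁) (rest b₁) + excess (clause a₂) (rest b₂)
  -- Witnesses in the same subtree give 2 there by recursion; witnesses in different subtrees give 1
  -- in each.
  total with Any.++⁻ (leafLabels l) d | Any.++⁻ (leafLabels l) e
  ... | inj₁ x | inj₁ y = ≤-trans (2≤excess a₁ b₁ p₁ q₁ ncˡ x y) (m≤m+n _ (excess (clause a₂) (rest b₂)))
  ... | inj₂ x | inj₂ y = ≤-trans (2≤excess a₂ b₂ p₂ q₂ ncʳ x y) (m≤n+m _ (excess (clause a₁) (rest b₁)))
  ... | inj₁ x | inj₂ y = +-mono-≤ (1≤excess {P} {Q} a₁ b₁ p₁ q₁ ncˡ (inj₁ x)) (1≤excess {P} {Q} a₂ b₂ p₂ q₂ ncʳ (inj₂ y))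
  ... | inj₂ x | inj₁ y = +-mono-≤ (1≤excess {P} {Q} a₁ b₁ p₁ q₁ ncˡ (inj₂ y)) (1≤excess {P} {Q} a₂ b₂ p₂ q₂ ncʳ (inj₁ x))

-- Subsets of fixed size

combinations : ∀ {A : Set} → ℕ → List A → List (List A)
combinations zero    _        = [] ∷ []
combinations (suc n) []       = []
combinations (suc n) (x ∷ xs) = map (x ∷_) (combinations n xs) ++ combinations (suc n) xs

length-combinations : ∀ {A : Set} n (xs : List A) → length (combinations n xs) ≡ length xs C n
length-combinations zero    xs       = refl
length-combinations (suc n) []       = refl
length-combinations (suc n) (x ∷ xs) = begin
  length (map (x ∷_) (combinations n xs) ++ combinations (suc n) xs)       ≡⟨ length-++ (map (x ∷_) (combinations n xs)) ⟩
  length (map (x ∷_) (combinations n xs)) + length (combinations (suc n) xs) ≡⟨ cong₂ _+_ (trans (length-map _ (combinations n xs)) (length-combinations n xs)) (length-combinations (suc n) xs) ⟩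
  length xs C n + length xs C suc n                                        ≡⟨ nCk+nC[k+1]≡[n+1]C[k+1] (length xs) n ⟩
  suc (length xs) C suc n ∎
  where open ≡-Reasoning

combinations-⊑ : ∀ {A : Set} n (xs : List A) → All (λ ys → ys ⊑ xs × length ys ≡ n) (combinations n xs)
combinations-⊑ zero    xs       = (Sub.minimum xs , refl) ∷ []
combinations-⊑ (suc n) []       = []
combinations-⊑ (suc n) (x ∷ xs) = All.++⁺
  (All.map⁺ (All.map (λ { (p , e) → refl ∷ p , cong suc e }) (combinations-⊑ n xs)))
  (All.map (λ { (p , e) → x ∷ʳ p , e }) (combinations-⊑ (suc n) xs))

Escapes : List ℕ → List ℕ → Set
Escapes ys zs = ∃ λ u → u ∈ ys × u ∉ zs

Incomparable : List ℕ → List ℕ → Set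
Incomparable ys zs = Escapes ys zs × Escapes zs ys

longer-escapes : ∀ {ys zs} → Unique ys → length zs < length ys → Escapes ys zs
longer-escapes {ys} {zs} u len with any? (λ y → ¬? (y ℕ∈.∈? zs)) ys
... | yes p = find p
... | no ¬p = contradiction (Unique-⊆⇒length≤ u (λ {y} y∈ → decidable-stable (y ℕ∈.∈? zs) (λ y∉ → ¬p (lose y∈ y∉)))) (<⇒≱ len)

-- Two subsets on the same side of the split by x are handled by induction. In a mixed pair, x
-- escapes one way; the other way, n + 1 elements different from x do not fit into the remaining n.
combinations-incomparable : ∀ n {xs} → Unique xs → AllPairs Incomparable (combinations n xs)
combinations-incomparable zero    _  = [] ∷ []
combinations-incomparable (suc n) [] = []
combinations-incomparable (suc n) {x ∷ xs} (x∉ ∷ u) = AllPairs.++⁺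
  (AllPairs.map⁺ (AllPairs-map-All (λ { {ys} {zs} p q ((a , a∈ , a∉) , (b , b∈ , b∉)) →
       (a , there a∈ , λ { (here refl) → x∉xs (Sub.lookup (proj₁ p) a∈) ; (there a∈′) → a∉ a∈′ })
     , (b , there b∈ , λ { (here refl) → x∉xs (Sub.lookup (proj₁ q) b∈) ; (there b∈′) → b∉ b∈′ }) })
     (combinations-⊑ n xs) (combinations-incomparable n u)))
  (combinations-incomparable (suc n) u)
  (All.map⁺ (All.map (λ { {ys} (p , e) → All.map (λ { {zs} (q , e′) →
       (x , here refl , λ x∈ → x∉xs (Sub.lookup q x∈))
     , longer-than-tail p e q e′ }) (combinations-⊑ (suc n) xs) }) (combinations-⊑ n xs)))
  where
  x∉xs : x ∉ xs
  x∉xs p = All.lookup x∉ p refl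
  AllPairs-map-All : ∀ {A : Set} {R S : A → A → Set} {T : A → Set} → (∀ {y z} → T y → T z → R y z → S y z) →
     ∀ {ys} → All T ys → AllPairs R ys → AllPairs S ys
  AllPairs-map-All f [] [] = []
  AllPairs-map-All f (t ∷ ts) (r ∷ rs) = All.zipWith (λ { (t′ , r′) → f t t′ r′ }) (ts , r) ∷ AllPairs-map-All f ts rs
  longer-than-tail : ∀ {ys zs} → ys ⊑ xs → length ys ≡ n → zs ⊑ xs → length zs ≡ suc n → Escapes zs (x ∷ ys)
  longer-than-tail p refl q e′ with longer-escapes (AllPairs-resp-⊑ q u) (≤-reflexive (sym e′))
  ... | w , w∈ , w∉ = w , w∈ , λ { (here refl) → x∉xs (Sub.lookup q w∈) ; (there w∈′) → w∉ w∈′ }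

AllPairs-lookup : ∀ {A : Set} {R : A → A → Set} {xs} → (∀ {x y} → R x y → R y x) → AllPairs R xs →
                  ∀ {i j} → i ≢ j → R (lookup xs i) (lookup xs j)
AllPairs-lookup sm (r ∷ rs) {zero}  {zero}  i≢j = contradiction refl i≢j
AllPairs-lookup sm (r ∷ rs) {zero}  {suc j} i≢j = All.lookup r (∈-lookup j)
AllPairs-lookup sm (r ∷ rs) {suc i} {zero}  i≢j = sm (All.lookup r (∈-lookup i))
AllPairs-lookup sm (r ∷ rs) {suc i} {suc j} i≢j = AllPairs-lookup sm rs (i≢j ∘ cong suc)

-- Sperner: the words are the ⌊m/2⌋-subsets of m of the leaves.
Code-zero : ∀ t m n → 1 ≤ n → Unique (leafLabels t) → m ≤ length (leafLabels t) → Code 0 t (m C n)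
Code-zero t m n 1≤n u m≤ = record
  { word = s ; apart = far
  ; disjoint = λ {i} {j} i≢j {E} isC imp nci ncj ei ej →
      -- Excess 0 puts word j inside E, so E has at least two literals outside word i.
      let j⊆E = All.lookup (Imp⇒clause⊆ (s j) imp ncj (excess≤0⇒All∉ (rest (s j)) ej))
          i≤0 = ≤-trans (excess-mono (rest (s i)) j⊆E) ei
      in contradiction (≤-trans (far (i≢j ∘ sym) (NoClash-anti (s i) j⊆E nci)) i≤0) λ () }
  where
  us = take m (leafLabels t)
  us⊑ : us ⊑ leafLabels t
  us⊑ = Sub.take-⊆ m (leafLabels t)
  subsets = combinations n us
  N≡ : m C n ≡ length subsets
  N≡ = sym (trans (length-combinations n us) (cong (_C n) (trans (length-take m (leafLabels t)) (m≤n⇒m⊓n≡m m≤))))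
  V : Fin (m C n) → List ℕ
  V i = lookup subsets (Fin.cast N≡ i)
  V-spec : ∀ i → V i ⊑ us × length (V i) ≡ n
  V-spec i = All.lookup (combinations-⊑ n us) (∈-lookup (Fin.cast N≡ i))
  V⊆ : ∀ i → V i ⊆ leafLabels t
  V⊆ i p = Sub.lookup us⊑ (Sub.lookup (proj₁ (V-spec i)) p)
  selection : ∀ i → ∃ λ (s : Sel t) → Selects (_∈ V i) s
  selection i with select (ℕ∈._∈? V i) t
  ... | inj₁ s = s
  -- As n is positive, the subset is nonempty and its first element is the label of a leaf.
  ... | inj₂ none with V i | proj₂ (V-spec i) | V⊆ i
  ...   | []    | e | _  = contradiction (≤-trans 1≤n (≤-reflexive (sym e))) λ ()
  ...   | x ∷ _ | _ | ⊆t = contradiction (here refl) (All.lookup none (⊆t (here refl)))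
  s : Fin (m C n) → Sel t
  s i = proj₁ (selection i)
  incomparable : ∀ {i j} → i ≢ j → Incomparable (V i) (V j)
  incomparable i≢j = AllPairs-lookup (λ { (p , q) → q , p }) (combinations-incomparable n (Unique.take⁺ m u))
    (i≢j ∘ cast-injective)
    where
    cast-injective : ∀ {i j} → Fin.cast N≡ i ≡ Fin.cast N≡ j → i ≡ j
    cast-injective {i} {j} e = Fin.toℕ-injective (trans (sym (Fin.toℕ-cast N≡ i)) (trans (cong Fin.toℕ e) (Fin.toℕ-cast N≡ j)))
  far : ∀ {i j} → i ≢ j → NoClash (clause (s i)) (s j) → 2 ≤ excess (clause (s i)) (rest (s j))
  far {i} {j} i≢j nc with incomparable i≢j
  ... | (a , a∈ , a∉) , (b , b∈ , b∉) = 2≤excess (s i) (s j) (proj₂ (selection i)) (proj₂ (selection j)) nc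
    (lose (V⊆ i a∈) (a∈ , a∉)) (lose (V⊆ j b∈) (b∈ , b∉))


-- Extremal trees

-- The tree is complete down to depth k. A common m for all subtrees at that depth gives their codes
-- the same index set, as `Code-node` requires.
DeepLeaves : ℕ → ℕ → Tree → Set
DeepLeaves zero    m S            = m ≤ length (F₁ S)
DeepLeaves (suc k) m leaf         = ⊥
DeepLeaves (suc k) m (node _ l r) = DeepLeaves k m l × DeepLeaves k m r

leafLabels-⊑ : ∀ t → leafLabels t ⊑ vars t
leafLabels-⊑ (leaf u)     = refl ∷ []
leafLabels-⊑ (node v l r) = v ∷ʳ Sub.++⁺ (leafLabels-⊑ l) (leafLabels-⊑ r)

DeepLeaves⇒Code : ∀ k {m n} t → 1 ≤ n → Unique (vars t) → DeepLeaves k m (skeleton t) → Code k t (m C n)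
DeepLeaves⇒Code zero    t 1≤n u d = Code-zero t _ _ 1≤n (AllPairs-resp-⊑ (leafLabels-⊑ t) u)
  (≤-trans d (≤-reflexive (length-F₁-skeleton t)))
DeepLeaves⇒Code (suc k) (node v l r) 1≤n u (dˡ , dʳ) =
  Code-node (DeepLeaves⇒Code k l 1≤n (Unique-left {v} {l} {r} u) dˡ) (DeepLeaves⇒Code k r 1≤n (Unique-right {v} {l} {r} u) dʳ)

Code⇒Matching : ∀ {k t N} → Unique (vars t) → Code k t N → MatchingNumber≥ (TriggerHypergraph k (clauses t)) N
Code⇒Matching {k} {t} u c =
    (λ i → clause (word c i) , clause-IsPrimeImplicate u (word c i))
  -- Each word lies in its own hyperedge, with empty difference.
  , (λ i → (clause (word c i) , clause-IsPrimeImplicate u (word c i))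
         , clause-IsClause u (word c i) , [] , z≤n , λ x p q → contradiction p q)
  , λ { i j i≢j (E , isC , F⊨E , _) ((dᵢ , cᵢ) , (dⱼ , cⱼ)) →
        disjoint c i≢j isC (⊨⇒Imp t u isC F⊨E) (noClash (word c i) dᵢ) (noClash (word c j) dⱼ)
          (excess≤CardDiff u (word c i) cᵢ) (excess≤CardDiff u (word c j) cⱼ) }
  where
  noClash : ∀ {E} (s : Sel t) → DisjointFromCompl E (clause s) → NoClash E s
  noClash s d = All.tabulate λ {x} x∈ cx∈ → d (compl x) cx∈ (subst (_∈ clause s) (sym (compl-involutive x)) x∈)

-- Extremality with bounds in place of the two equalities, so that it passes to subtrees without
-- determining their exact parameters.
Maximal : ℕ → ℕ → Tree → Set
Maximal κ h S = hts S ≤ κ × height S ≤ h × (∀ S′ → hts S′ ≤ κ → height S′ ≤ h → size S′ ≤ size S)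

hts-node-≤ : ∀ {κ} v l r → hts l ≤ κ → hts r ≤ suc κ → hts (node v l r) ≤ suc κ
hts-node-≤ v l r p q with hts l ≟ hts r
... | yes _ = s≤s p
... | no _  = ⊔-lub (m≤n⇒m≤1+n p) q

hts-node-≤′ : ∀ {κ} v l r → hts l ≤ suc κ → hts r ≤ κ → hts (node v l r) ≤ suc κ
hts-node-≤′ v l r p q with hts l ≟ hts r
... | yes e = s≤s (≤-trans (≤-reflexive e) q)
... | no _  = ⊔-lub p (m≤n⇒m≤1+n q)

-- At most one child may attain the bound, since two equal numbers raise the parent by one.
hts-node-≤⁻ : ∀ {κ} v l r → hts (node v l r) ≤ suc κ →
              (hts l ≤ κ × hts r ≤ suc κ) ⊎ (hts l ≤ suc κ × hts r ≤ κ)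
hts-node-≤⁻ {κ} v l r p with hts l ≟ hts r
... | yes e = inj₁ (s≤s⁻¹ p , ≤-trans (≤-reflexive (sym e)) (m≤n⇒m≤1+n (s≤s⁻¹ p)))
... | no l≢r with <-≤-connex (hts l) (hts r)
...   | inj₁ l<r = inj₁ (s≤s⁻¹ (≤-trans l<r (m⊔n≤o⇒n≤o _ _ p)) , m⊔n≤o⇒n≤o _ _ p)
...   | inj₂ r≤l = inj₂ (m⊔n≤o⇒m≤o _ _ p , s≤s⁻¹ (≤-trans (≤∧≢⇒< r≤l (l≢r ∘ sym)) (m⊔n≤o⇒m≤o _ _ p)))

-- The label 0 repeats, as extremality compares with all trees, whatever their labels.
comb : ℕ → Tree
comb zero    = leaf
comb (suc h) = node 0 leaf (comb h)

hts-comb : ∀ h → hts (comb h) ≤ 1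
hts-comb zero    = z≤n
hts-comb (suc h) = hts-node-≤ 0 leaf (comb h) z≤n (hts-comb h)

height-comb : ∀ h → height (comb h) ≤ h
height-comb zero    = z≤n
height-comb (suc h) = s≤s (height-comb h)

size-comb : ∀ h → suc (size (comb h)) ≡ 2 * suc h
size-comb zero    = refl
size-comb (suc h) = trans (cong (2 +_) (size-comb h)) (sym (*-suc 2 (suc h)))

size-leaves : ∀ S → suc (size S) ≡ 2 * length (F₁ S)
size-leaves leaf         = refl
size-leaves (node v l r) = begin
  2 + (size l + size r)                       ≡⟨ cong suc (+-suc (size l) (size r)) ⟨
  suc (size l) + suc (size r)                 ≡⟨ cong₂ _+_ (size-leaves l) (size-leaves r) ⟩
  2 * length (F₁ l) + 2 * length (F₁ r)       ≡⟨ *-distribˡ-+ 2 (length (F₁ l)) (length (F₁ r)) ⟨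
  2 * (length (F₁ l) + length (F₁ r))         ≡⟨ cong (2 *_) (cong₂ _+_ (length-map (pos v ∷_) (F₁ l)) (length-map (neg v ∷_) (F₁ r))) ⟨
  2 * (length (map (pos v ∷_) (F₁ l)) + length (map (neg v ∷_) (F₁ r))) ≡⟨ cong (2 *_) (length-++ (map (pos v ∷_) (F₁ l))) ⟨
  2 * length (F₁ (node v l r))                ∎
  where open ≡-Reasoning

Maximal⇒leaves : ∀ {κ h S} → 1 ≤ κ → Maximal κ h S → suc h ≤ length (F₁ S)
Maximal⇒leaves {κ} {h} {S} 1≤κ (_ , _ , max) = *-cancelˡ-≤ 2 (begin
  2 * suc h            ≡⟨ size-comb h ⟨
  suc (size (comb h))  ≤⟨ s≤s (max (comb h) (≤-trans (hts-comb h) 1≤κ) (height-comb h)) ⟩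
  suc (size S)         ≡⟨ size-leaves S ⟩
  2 * length (F₁ S)    ∎)
  where open ≤-Reasoning

-- Replacing a subtree by a larger one within the same bounds would enlarge the whole tree.
Maximal-node : ∀ {κ h v l r} → Maximal (suc κ) (suc h) (node v l r) →
               (Maximal κ h l × Maximal (suc κ) h r) ⊎ (Maximal (suc κ) h l × Maximal κ h r)
Maximal-node {κ} {h} {v} {l} {r} (hts≤ , s≤s height≤ , max) with hts-node-≤⁻ v l r hts≤
... | inj₁ (p , q) = inj₁
    ( (p , m⊔n≤o⇒m≤o _ _ height≤ , λ S p′ h′ → +-cancelʳ-≤ (size r) _ _ (s≤s⁻¹
         (max (node v S r) (hts-node-≤ v S r p′ q) (s≤s (⊔-lub h′ (m⊔n≤o⇒n≤o _ _ height≤))))))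
    , (q , m⊔n≤o⇒n≤o _ _ height≤ , λ S q′ h′ → +-cancelˡ-≤ (size l) _ _ (s≤s⁻¹
         (max (node v l S) (hts-node-≤ v l S p q′) (s≤s (⊔-lub (m⊔n≤o⇒m≤o _ _ height≤) h′))))))
... | inj₂ (p , q) = inj₂
    ( (p , m⊔n≤o⇒m≤o _ _ height≤ , λ S p′ h′ → +-cancelʳ-≤ (size r) _ _ (s≤s⁻¹
         (max (node v S r) (hts-node-≤′ v S r p′ q) (s≤s (⊔-lub h′ (m⊔n≤o⇒n≤o _ _ height≤))))))
    , (q , m⊔n≤o⇒n≤o _ _ height≤ , λ S q′ h′ → +-cancelˡ-≤ (size l) _ _ (s≤s⁻¹
         (max (node v l S) (hts-node-≤′ v l S p q′) (s≤s (⊔-lub (m⊔n≤o⇒m≤o _ _ height≤) h′))))))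

-- Each level lowers the height bound by one and the Horton-Strahler bound by at most one. At depth
-- k these bounds are j + 1 and at least 1, so a comb with j + 2 leaves is admissible for
-- comparison.
Maximal⇒DeepLeaves : ∀ k {κ j S} → k < κ → Maximal κ (k + suc j) S → DeepLeaves k (2 + j) S
Maximal⇒DeepLeaves zero            k<κ max = Maximal⇒leaves k<κ max
-- A single leaf is smaller than the comb allowed by the bounds, so it is not maximal.
Maximal⇒DeepLeaves (suc k) {S = leaf} k<κ max =
  contradiction (Maximal⇒leaves (≤-trans (s≤s z≤n) k<κ) max) λ { (s≤s ()) }
Maximal⇒DeepLeaves (suc k) {suc κ} {S = node v _ _} (s≤s k<κ) max with Maximal-node {v = v} max
... | inj₁ (p , q) = Maximal⇒DeepLeaves k k<κ p , Maximal⇒DeepLeaves k (m≤n⇒m≤1+n k<κ) q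
... | inj₂ (p , q) = Maximal⇒DeepLeaves k (m≤n⇒m≤1+n k<κ) p , Maximal⇒DeepLeaves k k<κ q

-- Central binomial coefficients

-- The absorption identity, by Pascal's rule and induction.
[1+k]*[1+n]C[1+k]≡[1+n]*nCk : ∀ n k → suc k * (suc n C suc k) ≡ suc n * (n C k)
[1+k]*[1+n]C[1+k]≡[1+n]*nCk zero    zero    = refl
[1+k]*[1+n]C[1+k]≡[1+n]*nCk zero    (suc k) = *-zeroʳ (2 + k)
[1+k]*[1+n]C[1+k]≡[1+n]*nCk (suc n) zero    = trans (+-identityʳ _) (trans (nC1≡n (2 + n)) (sym (*-identityʳ (2 + n))))
[1+k]*[1+n]C[1+k]≡[1+n]*nCk (suc n) (suc k) = begin
  (2 + k) * (suc (suc n) C (2 + k))                                ≡⟨ cong ((2 + k) *_) (nCk+nC[k+1]≡[n+1]C[k+1] (suc n) (suc k)) ⟨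
  (2 + k) * (x + suc n C (2 + k))                                  ≡⟨ *-distribˡ-+ (2 + k) x _ ⟩
  (x + suc k * x) + (2 + k) * (suc n C (2 + k))                    ≡⟨ cong₂ (λ y z → (x + y) + z) ([1+k]*[1+n]C[1+k]≡[1+n]*nCk n k) ([1+k]*[1+n]C[1+k]≡[1+n]*nCk n (suc k)) ⟩
  (x + suc n * (n C k)) + suc n * (n C suc k)                      ≡⟨ +-assoc x _ _ ⟩
  x + (suc n * (n C k) + suc n * (n C suc k))                      ≡⟨ cong (x +_) (*-distribˡ-+ (suc n) (n C k) _) ⟨
  x + suc n * (n C k + n C suc k)                                  ≡⟨ cong (λ y → x + suc n * y) (nCk+nC[k+1]≡[n+1]C[k+1] n k) ⟩
  (2 + n) * x                                                      ∎
  where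
  open ≡-Reasoning
  x = suc n C suc k

-- The central coefficients for m = 2n and m = 2n + 1.
evenC oddC : ℕ → ℕ
evenC n = (n * 2) C n
oddC n = suc (n * 2) C n

-- By symmetry the lower index n may be replaced by n + 1, after which absorption applies.
oddC-evenC : ∀ n → suc n * oddC n ≡ suc (n * 2) * evenC n
oddC-evenC n = trans (cong (suc n *_) (trans (nCk≡nC[n∸k] n≤) (cong (suc (n * 2) C_) e))) ([1+k]*[1+n]C[1+k]≡[1+n]*nCk (n * 2) n)
  where
  n≤ : n ≤ suc (n * 2)
  n≤ = m≤n⇒m≤1+n (m≤m*n n 2)
  e : suc (n * 2) ∸ n ≡ suc n
  e = trans (cong (_∸ n) (eq n)) (m+n∸n≡m (suc n) n)
    where
    eq : ∀ n → suc (n * 2) ≡ suc n + n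
    eq = solve-∀

evenC-oddC : ∀ n → evenC (suc n) ≡ 2 * oddC n
evenC-oddC n = *-cancelˡ-≡ _ _ (suc n) (trans ([1+k]*[1+n]C[1+k]≡[1+n]*nCk (suc (n * 2)) n) (eq n (oddC n)))
  where
  eq : ∀ n x → suc (suc (n * 2)) * x ≡ suc n * (2 * x)
  eq = solve-∀

evenC-suc : ∀ n → suc n * evenC (suc n) ≡ 2 * suc (n * 2) * evenC n
evenC-suc n = begin
  suc n * evenC (suc n) ≡⟨ cong (suc n *_) (evenC-oddC n) ⟩
  suc n * (2 * oddC n) ≡⟨ eq n (oddC n) ⟩
  2 * (suc n * oddC n) ≡⟨ cong (2 *_) (oddC-evenC n) ⟩
  2 * (suc (n * 2) * evenC n) ≡⟨ *-assoc 2 (suc (n * 2)) (evenC n) ⟨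
  2 * suc (n * 2) * evenC n ∎
  where
  open ≡-Reasoning
  eq : ∀ n x → suc n * (2 * x) ≡ 2 * (suc n * x)
  eq = solve-∀

oddC-suc : ∀ n → (2 + n) * oddC (suc n) ≡ 2 * (3 + n * 2) * oddC n
oddC-suc n = begin
  (2 + n) * oddC (suc n) ≡⟨ oddC-evenC (suc n) ⟩
  (3 + n * 2) * evenC (suc n) ≡⟨ cong ((3 + n * 2) *_) (evenC-oddC n) ⟩
  (3 + n * 2) * (2 * oddC n) ≡⟨ eq (3 + n * 2) (oddC n) ⟩
  2 * (3 + n * 2) * oddC n ∎
  where
  open ≡-Reasoning
  eq : ∀ n x → n * (2 * x) ≡ 2 * n * x
  eq = solve-∀

-- The inequality x > 2^m / √(2m), squared and cleared of denominators.
Bound : ℕ → ℕ → Set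
Bound m x = 2 ^ (2 * m) < 2 * m * (x * x)

pow-Bound-step : ∀ m → 2 ^ (2 * (2 + m)) ≡ 16 * 2 ^ (2 * m)
pow-Bound-step m = trans (cong (2 ^_) (*-distribˡ-+ 2 2 m)) (^-distribˡ-+-* 2 4 (2 * m))

-- Passing from m to m + 2 multiplies the left side of `Bound` by 16, and q / p is the growth factor
-- of the coefficient. The slack d turns the required inequality into a polynomial identity.
Bound-step : ∀ p q d m x y → p * y ≡ q * x → .{{NonZero p}} →
       (2 + m) * (q * q) ≡ 16 * (m * (p * p)) + d → Bound m x → Bound (2 + m) y
Bound-step p q d m x y rec ineq bd = *-cancelˡ-< ((p * p)) _ _ (begin-strict
  (p * p) * 2 ^ (2 * (2 + m))          ≡⟨ cong ((p * p) *_) (pow-Bound-step m) ⟩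
  (p * p) * (16 * 2 ^ (2 * m))         ≡⟨ *-assoc ((p * p)) 16 _ ⟨
  ((p * p) * 16) * 2 ^ (2 * m)         <⟨ *-monoʳ-< ((p * p) * 16) {{m*n≢0 ((p * p)) 16 {{m*n≢0 p p}}}} bd ⟩
  ((p * p) * 16) * (2 * m * (x * x))     ≡⟨ eq₁ p m x ⟩
  2 * (x * x) * (16 * (m * (p * p)))     ≤⟨ *-monoʳ-≤ (2 * (x * x)) (≤-trans (m≤m+n _ d) (≤-reflexive (sym ineq))) ⟩
  2 * (x * x) * ((2 + m) * (q * q))      ≡⟨ eq₂ q m x ⟩
  2 * (2 + m) * (q * x * (q * x))          ≡⟨ cong (λ z → 2 * (2 + m) * (z * z)) rec ⟨
  2 * (2 + m) * (p * y * (p * y))          ≡⟨ eq₃ p m y ⟩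
  (p * p) * (2 * (2 + m) * (y * y))      ∎)
  where
  open ≤-Reasoning
  eq₁ : ∀ p m x → ((p * p) * 16) * (2 * m * (x * x)) ≡ 2 * (x * x) * (16 * (m * (p * p)))
  eq₁ = solve-∀
  eq₂ : ∀ q m x → 2 * (x * x) * ((2 + m) * (q * q)) ≡ 2 * (2 + m) * (q * x * (q * x))
  eq₂ = solve-∀
  eq₃ : ∀ p m y → 2 * (2 + m) * (p * y * (p * y)) ≡ (p * p) * (2 * (2 + m) * (y * y))
  eq₃ = solve-∀

Bound-evenC : ∀ i → Bound ((3 + i) * 2) (evenC (3 + i))
-- For m = 6 the coefficient is 20, and 12 · 20² = 4800 = 4096 + 704.
Bound-evenC zero    = m<m+n 4096 {704} (s≤s z≤n)
Bound-evenC (suc i) = Bound-step (4 + i) (2 * suc ((3 + i) * 2)) (8 * (4 + i)) ((3 + i) * 2) (evenC (3 + i)) (evenC (4 + i)) (evenC-suc (3 + i)) (eq i) (Bound-evenC i)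
  where
  eq : ∀ i → (2 + (3 + i) * 2) * (2 * suc ((3 + i) * 2) * (2 * suc ((3 + i) * 2))) ≡ 16 * ((3 + i) * 2 * ((4 + i) * (4 + i))) + 8 * (4 + i)
  eq = solve-∀

Bound-oddC : ∀ i → Bound (suc ((3 + i) * 2)) (oddC (3 + i))
-- For m = 7 the coefficient is 35, and 14 · 35² = 17150 = 16384 + 766.
Bound-oddC zero    = m<m+n 16384 {766} (s≤s z≤n)
Bound-oddC (suc i) = Bound-step (5 + i) (2 * (3 + (3 + i) * 2)) (4 * (6 * (3 + i) + 11)) (suc ((3 + i) * 2)) (oddC (3 + i)) (oddC (4 + i)) (oddC-suc (3 + i)) (eq i) (Bound-oddC i)
  where
  eq : ∀ i → (2 + suc ((3 + i) * 2)) * (2 * (3 + (3 + i) * 2) * (2 * (3 + (3 + i) * 2))) ≡ 16 * (suc ((3 + i) * 2) * ((5 + i) * (5 + i))) + 4 * (6 * (3 + i) + 11)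
  eq = solve-∀

parity : ∀ m → ∃ λ n → m ≡ n * 2 ⊎ m ≡ suc (n * 2)
parity zero = 0 , inj₁ refl
parity (suc m) with parity m
... | n , inj₁ refl = n , inj₂ refl
... | n , inj₂ refl = suc n , inj₁ refl

Bound-central : ∀ m → 6 ≤ m → Bound m (m C (m / 2))
Bound-central m 6≤m with parity m
... | n , inj₁ refl with m≤n⇒∃[o]m+o≡n (*-cancelʳ-≤ 3 n 2 6≤m)
...   | i , refl = subst (λ z → Bound ((3 + i) * 2) (((3 + i) * 2) C z)) (sym (m*n/n≡m (3 + i) 2)) (Bound-evenC i)
-- From 6 ≤ 2n + 1 follows 3 · 2 < (n + 1) · 2, hence n ≥ 3.
Bound-central m 6≤m | n , inj₂ refl with m≤n⇒∃[o]m+o≡n (s≤s⁻¹ (*-cancelʳ-< 2 3 (suc n) (s≤s 6≤m)))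
... | i , refl = subst (λ z → Bound (suc ((3 + i) * 2)) (suc ((3 + i) * 2) C z)) (sym half) (Bound-oddC i)
  where
  half : suc ((3 + i) * 2) / 2 ≡ 3 + i
  half = trans (+-distrib-/-∣ʳ 1 {(3 + i) * 2} {2} (n∣m*n (3 + i))) (m*n/n≡m (3 + i) 2)

-- The matching in the trigger hypergraph

theorem6p13 : (k h : ℕ) → suc k ≤ h → (T : Tree) →
    IsExtremal (suc k) h T → InjectivelyLabelled T →
    (us : List ℕ) → ValidDoping (F₁ T) us →
    let F = D (F₁ T) us
        m = suc h ∸ k
    in MatchingNumber≥ (TriggerHypergraph k F) (m C (m / 2))
       × (k + 5 ≤ h → 2 ^ (2 * m) < 2 * m * ((m C (m / 2)) ^ 2))
theorem6p13 k h k<h T (hts≡ , height≡ , max) inj us doping@(len , _) with attach T us len | m≤n⇒∃[o]m+o≡n k<h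
... | t , refl , refl | j , refl = Code⇒Matching u code , λ k+5≤h → subst (λ z → 2 ^ (2 * m) < 2 * m * z) (sym (cong (x *_) (*-identityʳ x))) (Bound-central m (6≤m k+5≤h))
  where
  m = suc h ∸ k
  x = m C (m / 2)
  -- With h = k + 1 + j, the subtrees at depth k have height bound j + 1 = m - 1, hence at least m
  -- leaves.
  m≡ : m ≡ 2 + j
  m≡ = trans (cong (λ z → suc z ∸ k) (sym (+-suc k j))) (trans (cong (_∸ k) (sym (+-suc k (suc j)))) (m+n∸m≡n k (2 + j)))
  u : Unique (vars t)
  u = doping-Unique t inj doping
  deep : DeepLeaves k m T
  deep = subst (λ z → DeepLeaves k z T) (sym m≡) (Maximal⇒DeepLeaves k (n<1+n k)
    ( ≤-reflexive hts≡ , ≤-reflexive (trans height≡ (sym (+-suc k j)))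
    , λ S p q → max S p (≤-trans q (≤-reflexive (+-suc k j)))))
  code : Code k t (m C (m / 2))
  -- Since m is at least 2, the chosen subsets of size ⌊m/2⌋ are nonempty.
  code = DeepLeaves⇒Code k t (m≥n⇒m/n>0 (≤-trans (s≤s (s≤s z≤n)) (≤-reflexive (sym m≡)))) u deep
  6≤m : k + 5 ≤ h → 6 ≤ m
  6≤m p = m+n≤o⇒m≤o∸n 6 (≤-trans (≤-reflexive (cong suc (+-comm 5 k))) (s≤s p))
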